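{- Let $\lambda$ be a partition, $n\ge \ell(\lambda)$, and $M\in\mathrm{MLQ}(\lambda,n)$. Then $\mathrm{maj}(M)=\mathrm{charge}(\mathrm{cw}(M))$.
   Context: A multiline queue of shape $\lambda$ on $n$ columns is a tuple $M=(B_1,\dots,B_L)$, $L=\lambda_1$, of subsets $B_r\subseteq\{1,\dots,n\}$ with $|B_r|=\lambda'_r$ ($\lambda'$ the conjugate partition); it is drawn as an array with rows $1,\dots,L$ from bottom to top and columns $1,\dots,n$ from left to right, with a ball at site $(r,j)$ iff $j\in B_r$. $\mathrm{MLQ}(\lambda,n)$ is the set of these. The column word $\mathrm{cw}(M)$ records the row number of each ball, scanning the columns from left to right and, within each column, from top to bottom (so it has $\lambda'_r$ letters $r$). Ferrari–Martin labelling and major index: for $r=L,L-1,\dots,2$, every not yet labelled ball of row $r$ receives label $r$; then the balls of row $r$ are taken in order of decreasing label, and from left to right among equal labels, and each in turn is paired with the first not yet labelled ball of row $r-1$ found by searching weakly to its right, cyclically (continuing from column $n$ to column $1$); that ball receives the same label. A pairing wraps if the ball reached in row $r-1$ lies in a column strictly smaller than the starting column. Finally unlabelled balls of row $1$ receive label $1$. Then $\mathrm{maj}(M)=\sum_p(\ell(p)-r(p)+1)$, summed over wrapping pairings $p$, where $\ell(p)$ is the label and $r(p)$ the row from which $p$ starts. Charge: for a permutation $\tau$ of $[k]$ in one-line notation, $\mathrm{charge}(\tau)=\sum_{i\in[k-1],\ \tau^{ -1}(i)<\tau^{ -1}(i+1)}(k-i)$. Let $w$ be a word with partition content (the number $\mu_i$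 of letters $i$ satisfies $\mu_1\ge\mu_2\ge\cdots$) and let $k$ be its largest letter. Scanning from the left, pick the first occurrence of $k$, then the next occurrence of $k-1$ to its right, then of $k-2$, …, down to $1$, each time continuing to the right and returning cyclically to the beginning of $w$ when needed; these letters, in the order in which they occur in $w$, form a permutation $w^{(1)}$ of $[k]$. Remove them and repeat on the remaining word to get $w^{(2)},w^{(3)},\dots$ until the word is exhausted. Then $\mathrm{charge}(w)=\sum_j\mathrm{charge}(w^{(j)})$. -}

module Defs where

open import Data.Nat using (ℕ; zero; suc; _+_; _∸_; _≤_; _<ᵇ_; _≡ᵇ_)
open import Data.Nat.Base using (_⊔_)
open import Data.Bool using (Bool; true; false; if_then_else_)
open import Data.Product using (_×_; _,_; proj₁; proj₂)
open import Data.Maybe using (Maybe; just; nothing)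
open import Data.List using (List; []; _∷_; map; length; foldl; foldr; reverse; concatMap; filterᵇ; upTo; applyUpTo)
open import Data.List.Relation.Unary.All using (All)
open import Data.Nat.ListAction using (sum)
open import Data.List.Relation.Unary.Linked using (Linked)
open import Data.Fin using (Fin; toℕ)
open import Data.Fin.Subset using (Subset; ∣_∣)
open import Data.Vec using (Vec; lookup; toList; allFin)
open import Relation.Binary.PropositionalEquality using (_≡_)

IsPartition : List ℕ → Set
IsPartition p = Linked (λ a b → b ≤ a) p × All (λ a → 1 ≤ a) p

largest : List ℕ → ℕ
largest [] = 0
largest (x ∷ _) = x

conj : List ℕ → ℕ → ℕ
conj p r = length (filterᵇ (λ a → r ≤ᵇ' a) p)
  where
  _≤ᵇ'_ : ℕ → ℕ → Bool
  x ≤ᵇ' y = x <ᵇ suc y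

-- Multiline queues.  M : Vec (Subset n) (largest λ); the entry with
-- index i : Fin L is the set B_r of row r = toℕ i + 1 (rows 1..L, bottom
-- to top); column j : Fin n is column toℕ j + 1.  Ball at (r , j) iff
-- lookup M i j = true.

IsMLQ : (p : List ℕ) {n : ℕ} → Vec (Subset n) (largest p) → Set
IsMLQ p M = (i : Fin (largest p)) → ∣ lookup M i ∣ ≡ conj p (suc (toℕ i))

cw : {L n : ℕ} → Vec (Subset n) L → List ℕ
cw {L} {n} M =
  concatMap (λ j → concatMap (λ i → if lookup (lookup M i) j then suc (toℕ i) ∷ [] else [])
                              (reverse (toList (allFin L))))
            (toList (allFin n))

-- Ferrari–Martin labelling and major index.
-- Columns are represented by their (0-based) index toℕ j; a row is the
-- increasing list of columns containing a ball.  A labelled ball is a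
-- pair (column , label).

rowCols : {n : ℕ} → Subset n → List ℕ
rowCols {n} B = map toℕ (filterᵇ (lookup B) (toList (allFin n)))

-- the first not yet labelled ball of the row below, searching weakly to the
-- right of column c, cyclically; the Bool says whether the pairing wraps
-- (i.e. the column found is strictly smaller than c).
pick : ℕ → List ℕ → Maybe (ℕ × Bool)
pick c avail with filterᵇ (λ x → c <ᵇ suc x) avail
... | x ∷ _ = just (x , false)
... | [] with avail
...   | [] = nothing
...   | x ∷ _ = just (x , true)

removeCol : ℕ → List ℕ → List ℕ
removeCol x = filterᵇ (λ y → if y ≡ᵇ x then false else true)

-- pair the balls of row r (already in processing order) with the free
-- balls of row r-1; returns the labelled balls of row r-1 and the
-- contribution  Σ (ℓ(p) - r + 1)  of the wrapping pairings.
pairRow : (r : ℕ) → List (ℕ × ℕ) → List ℕ → List (ℕ × ℕ) × ℕ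
pairRow r [] avail = [] , 0
pairRow r ((c , l) ∷ bs) avail with pick c avail
... | nothing = pairRow r bs avail
... | just (x , w) =
  let rec = pairRow r bs (removeCol x avail) in
  ((x , l) ∷ proj₁ rec) , ((if w then (l + 1) ∸ r else 0) + proj₂ rec)

labelOf : ℕ → List (ℕ × ℕ) → ℕ → ℕ
labelOf c [] r = r
labelOf c ((c' , l) ∷ xs) r = if c' ≡ᵇ c then l else labelOf c xs r

insDesc : ℕ × ℕ → List (ℕ × ℕ) → List (ℕ × ℕ)
insDesc b [] = b ∷ []
insDesc (c , l) ((c' , l') ∷ xs) =
  if l' <ᵇ l then (c , l) ∷ (c' , l') ∷ xs else (c' , l') ∷ insDesc (c , l) xs

-- order: decreasing label, left to right among equal labels
processOrder : List (ℕ × ℕ) → List (ℕ × ℕ)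
processOrder bs = foldl (λ acc b → insDesc b acc) [] bs

-- fmMaj r lab rows : rows = (row r , row r-1 , ... , row 1), lab = the
-- labelled balls of row r coming from row r+1.
fmMaj : ℕ → List (ℕ × ℕ) → List (List ℕ) → ℕ
fmMaj r lab [] = 0
fmMaj r lab (row ∷ []) = 0
fmMaj r lab (row ∷ rest@(next ∷ _)) =
  let balls = map (λ c → (c , labelOf c lab r)) row
      res   = pairRow r (processOrder balls) next
  in proj₂ res + fmMaj (r ∸ 1) (proj₁ res) rest

maj : {L n : ℕ} → Vec (Subset n) L → ℕ
maj {L} M = fmMaj L [] (reverse (toList (Data.Vec.map rowCols M)))

indexOf : ℕ → List ℕ → ℕ
indexOf a [] = 0
indexOf a (x ∷ xs) = if x ≡ᵇ a then 0 else suc (indexOf a xs)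

chargePerm : List ℕ → ℕ
chargePerm τ =
  sum (map (λ i → if indexOf i τ <ᵇ indexOf (suc i) τ then k ∸ i else 0)
           (applyUpTo suc (k ∸ 1)))
  where k = length τ

maxLetter : List (ℕ × ℕ) → ℕ
maxLetter = foldr (λ e m → proj₂ e ⊔ m) 0

-- positioned word: list of (position , letter)
-- next occurrence of letter m strictly to the right of position cur,
-- cyclically
nextOcc : ℕ → ℕ → List (ℕ × ℕ) → Maybe ℕ
nextOcc m cur w with filterᵇ (λ e → (proj₂ e ≡ᵇ m) ∧' (cur <ᵇ proj₁ e)) w
  where
  _∧'_ : Bool → Bool → Bool
  true ∧' b = b
  false ∧' _ = false
... | e ∷ _ = just (proj₁ e)
... | [] with filterᵇ (λ e → proj₂ e ≡ᵇ m) w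
...   | e ∷ _ = just (proj₁ e)
...   | [] = nothing

chooseFrom : ℕ → ℕ → List (ℕ × ℕ) → List ℕ
chooseFrom zero cur w = []
chooseFrom (suc m) cur w with nextOcc (suc m) cur w
... | nothing = chooseFrom m cur w
... | just p = p ∷ chooseFrom m p w

memb : ℕ → List ℕ → Bool
memb x [] = false
memb x (y ∷ ys) = if y ≡ᵇ x then true else memb x ys

-- positions of the first standard subword: first occurrence of k, then
-- cyclically the next k-1, ..., 1
firstChosen : List (ℕ × ℕ) → List ℕ
firstChosen w with maxLetter w
... | zero = []
... | suc k with filterᵇ (λ e → proj₂ e ≡ᵇ suc k) w
...   | [] = []
...   | e ∷ _ = proj₁ e ∷ chooseFrom k (proj₁ e) w

-- sum of the charges of the successive standard subwords; the fuel
-- (length of the word) suffices since every round removes ≥ 1 letter.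
chargeRounds : ℕ → List (ℕ × ℕ) → ℕ
chargeRounds zero w = 0
chargeRounds (suc f) w =
  let ch  = firstChosen w
      sub = map proj₂ (filterᵇ (λ e → memb (proj₁ e) ch) w)
      rem = filterᵇ (λ e → if memb (proj₁ e) ch then false else true) w
  in chargePerm sub + chargeRounds f rem

positioned : List ℕ → List (ℕ × ℕ)
positioned w = go 0 w
  where
  go : ℕ → List ℕ → List (ℕ × ℕ)
  go i [] = []
  go i (x ∷ xs) = (i , x) ∷ go (suc i) xs

charge : List ℕ → ℕ
charge w = chargeRounds (length w) (positioned w)

{-# OPTIONS --safe #-}

-- If two balls of equal label compete for a site, the loser is paired with
-- the next free site cyclically to the right, whichever of them it is, and the
-- number of wraps is the same, provided there is room for both.  Rows grow
-- downwards, so balls of equal label may be processed in any order, and row by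
-- row pairing amounts to following one strand after another: the strand from
-- the leftmost ball of the top nonempty row can be followed down to row 1 and
-- removed before any other pairing is made.  In the column word the cyclic
-- search for the next letter traces the same strand, and since letters within a
-- column are read from top to bottom, the pairing from row r wraps exactly when
-- r - 1 precedes r in the word.  So each round of charge accounts for one strand.

module Submission where

open import Defs
open import Data.Bool using (Bool; true; false; if_then_else_; T; T?; _∧_)
open import Data.Bool.Properties using (T-∧)
open import Data.Empty using (⊥-elim)
open import Data.Fin as Fin using (Fin; toℕ; fromℕ<)
open import Data.Fin.Properties as Finₚ using ()
open import Data.Fin.Subset using (Subset; ∣_∣)
open import Data.List as List using (List; []; _∷_; _++_; map; length; foldl; reverse; filterᵇ; applyUpTo; applyDownFrom; concatMap)
open import Data.List.Membership.Propositional using (_∈_; lose)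
open import Data.List.Membership.Propositional.Properties using (∈-filter⁺; ∈-filter⁻; ∈-∃++; ∈-map⁺; ∈-map⁻; ∈-allFin)
open import Data.List.Membership.Propositional.Properties.WithK using (unique∧set⇒bag)
open import Data.List.Properties using (filter-all; filter-notAll; filter-++; map-cong-local; map-++; map-∘; map-concatMap; concatMap-cong; length-map; applyUpTo-∷ʳ; unfold-reverse; reverse-applyUpTo; ++-identityʳ)
open import Data.List.Relation.Binary.BagAndSetEquality using (∼bag⇒↭)
open import Data.List.Relation.Binary.Permutation.Propositional using (_↭_; prep; swap; ↭-refl; ↭-sym; ↭-trans; ↭-reflexive)
open import Data.List.Relation.Binary.Permutation.Propositional.Properties as Permₚ using (All-resp-↭; ∈-resp-↭; drop-mid; ↭-empty-inv; ↭-reverse)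
open import Data.List.Relation.Unary.All as All using (All; []; _∷_)
open import Data.List.Relation.Unary.All.Properties as Allₚ using ()
open import Data.List.Relation.Unary.AllPairs as AllPairs using (AllPairs; []; _∷_)
open import Data.List.Relation.Unary.AllPairs.Properties as AllPairsₚ using ()
open import Data.List.Relation.Unary.Any using (here; there)
open import Data.List.Relation.Unary.Any.Properties using (reverse⁺)
open import Data.List.Relation.Unary.Linked as Linked using (Linked; []; [-]; _∷_)
open import Data.List.Relation.Unary.Unique.Propositional using (Unique)
open import Data.Maybe using (Maybe; just; nothing)
open import Data.Nat using (ℕ; zero; suc; _+_; _∸_; _≤_; _<_; _<ᵇ_; _≡ᵇ_; z≤n; s≤s)
open import Data.Nat.ListAction using (sum)
open import Data.Nat.ListAction.Properties using (sum-++)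
open import Data.Nat.Properties
open import Algebra.Properties.CommutativeSemigroup +-commutativeSemigroup using (x∙yz≈y∙xz; interchange)
open import Data.Product using (_×_; _,_; proj₁; proj₂; ∃)
open import Data.Sum using (_⊎_; inj₁; inj₂)
open import Data.Unit using (⊤; tt)
open import Data.Vec as Vec using (Vec; lookup; toList; allFin)
open import Data.Vec.Properties as Vecₚ using ()
open import Function using (Equivalence; case_of_; _∘_; id; mk⇔; flip)
open import Relation.Binary.PropositionalEquality
open import Relation.Nullary using (yes; no; ¬_)

private variable
  A B : Set


-- Sorted rows and removal of a column.

Sorted : List ℕ → Set
Sorted = AllPairs _<_

≡true⇒T : ∀ {b} → b ≡ true → T b
≡true⇒T refl = tt

≡false⇒¬T : ∀ {b} → b ≡ false → ¬ T b
≡false⇒¬T refl ()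

T⇒≡true : ∀ {b} → T b → b ≡ true
T⇒≡true {true} _ = refl

¬T⇒≡false : ∀ {b} → ¬ T b → b ≡ false
¬T⇒≡false {true} h = ⊥-elim (h tt)
¬T⇒≡false {false} _ = refl

if-flip : ∀ {b} → T (if b then false else true) → ¬ T b
if-flip {false} _ = id

if-flip⁻ : ∀ {b} → ¬ T b → T (if b then false else true)
if-flip⁻ {true} h = h tt
if-flip⁻ {false} _ = tt

filterᵇ-comm : (p q : A → Bool) (xs : List A) → filterᵇ p (filterᵇ q xs) ≡ filterᵇ q (filterᵇ p xs)
filterᵇ-comm p q [] = refl
filterᵇ-comm p q (x ∷ xs) with p x in ep | q x in eq
... | true  | true  rewrite ep | eq = cong (x ∷_) (filterᵇ-comm p q xs)
... | true  | false rewrite eq = filterᵇ-comm p q xs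
... | false | true  rewrite ep = filterᵇ-comm p q xs
... | false | false = filterᵇ-comm p q xs

removeCol-comm : ∀ x y xs → removeCol x (removeCol y xs) ≡ removeCol y (removeCol x xs)
removeCol-comm x y = filterᵇ-comm _ _

∈-removeCol⁻ : ∀ {x y} xs → y ∈ removeCol x xs → y ∈ xs × y ≢ x
∈-removeCol⁻ {x} {y} xs y∈ with ∈-filter⁻ (T? ∘ λ y → if y ≡ᵇ x then false else true) {xs = xs} y∈
... | y∈xs , t = y∈xs , λ y≡x → if-flip t (≡⇒≡ᵇ y x y≡x)

∈-removeCol⁺ : ∀ {x y xs} → y ∈ xs → y ≢ x → y ∈ removeCol x xs
∈-removeCol⁺ {x} {y} y∈xs y≢x = ∈-filter⁺ (T? ∘ λ y → if y ≡ᵇ x then false else true) y∈xs (if-flip⁻ (y≢x ∘ ≡ᵇ⇒≡ y x))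

removeCol-Sorted : ∀ {x xs} → Sorted xs → Sorted (removeCol x xs)
removeCol-Sorted = AllPairsₚ.filter⁺ _

removeCol-∉ : ∀ {x xs} → All (_≢ x) xs → removeCol x xs ≡ xs
removeCol-∉ {x} h = filter-all _ (All.map (λ {y} y≢x → if-flip⁻ (y≢x ∘ ≡ᵇ⇒≡ y x)) h)

removeCol-head : ∀ {x xs} → All (x <_) xs → removeCol x (x ∷ xs) ≡ xs
removeCol-head {x} h rewrite T⇒≡true (≡⇒≡ᵇ x x refl) = removeCol-∉ (All.map (λ x<y y≡x → <⇒≢ x<y (sym y≡x)) h)

↭-removeCol : ∀ {x xs} → Sorted xs → x ∈ xs → xs ↭ x ∷ removeCol x xs
↭-removeCol {x} (h ∷ _) (here refl) rewrite removeCol-head h = ↭-refl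
↭-removeCol {x} {y ∷ xs} (h ∷ hs) (there x∈xs)
  rewrite ¬T⇒≡false (λ t → <⇒≢ (All.lookup h x∈xs) (≡ᵇ⇒≡ y x t))
  = ↭-trans (prep y (↭-removeCol hs x∈xs)) (swap y x ↭-refl)

-- The cyclic search for a free ball.

-- Describes the result of `pick` by minimality instead of as the head of a filtered list. In this
-- form, searches in a row before and after a removal can be compared.
data Pick (c : ℕ) (A : List ℕ) (x : ℕ) : Bool → Set where
  direct  : x ∈ A → c ≤ x → (∀ {y} → y ∈ A → c ≤ y → x ≤ y) → Pick c A x false
  wrapped : x ∈ A → (∀ {y} → y ∈ A → y < c) → (∀ {y} → y ∈ A → x ≤ y) → Pick c A x true

data PickView (c : ℕ) (A : List ℕ) : Maybe (ℕ × Bool) → Set where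
  none : A ≡ [] → PickView c A nothing
  some : ∀ {x w} → Pick c A x w → PickView c A (just (x , w))

head-least : ∀ {x xs} → Sorted (x ∷ xs) → ∀ {y} → y ∈ x ∷ xs → x ≤ y
head-least (h ∷ _) (here refl) = ≤-refl
head-least (h ∷ _) (there y∈) = <⇒≤ (All.lookup h y∈)

pickView : ∀ c {A} → Sorted A → PickView c A (pick c A)
pickView c {A} sA with filterᵇ (λ x → c <ᵇ suc x) A in eq
... | x ∷ xs with ∈-filter⁻ (T? ∘ λ x → c <ᵇ suc x) {xs = A} (subst (x ∈_) (sym eq) (here refl))
...   | x∈A , t = some (direct x∈A (≤-pred (<ᵇ⇒< _ _ t)) λ y∈A c≤y →
          head-least (subst Sorted eq (AllPairsₚ.filter⁺ (T? ∘ λ x → c <ᵇ suc x) sA))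
            (subst (_ ∈_) eq (∈-filter⁺ (T? ∘ λ x → c <ᵇ suc x) y∈A (<⇒<ᵇ (s≤s c≤y)))))
pickView c {A} sA | [] with A
... | [] = none refl
... | x ∷ xs = some (wrapped (here refl) all< (head-least sA))
  where
  all< : ∀ {y} → y ∈ x ∷ xs → y < c
  all< {y} y∈ with y <? c
  ... | yes y<c = y<c
  ... | no y≮c with () ← subst (y ∈_) eq (∈-filter⁺ (T? ∘ λ x → c <ᵇ suc x) y∈ (<⇒<ᵇ (s≤s (≮⇒≥ y≮c))))

Pick-functional : ∀ {c A x y v w} → Pick c A x v → Pick c A y w → (x , v) ≡ (y , w)
Pick-functional (direct x∈ c≤x lx) (direct y∈ c≤y ly) = cong (_, false) (≤-antisym (lx y∈ c≤y) (ly x∈ c≤x))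
Pick-functional (direct x∈ c≤x lx) (wrapped y∈ ub ly) = ⊥-elim (<⇒≱ (ub x∈) c≤x)
Pick-functional (wrapped x∈ ub lx) (direct y∈ c≤y ly) = ⊥-elim (<⇒≱ (ub y∈) c≤y)
Pick-functional (wrapped x∈ _ lx) (wrapped y∈ _ ly) = cong (_, true) (≤-antisym (lx y∈) (ly x∈))

Pick-∈ : ∀ {c A x w} → Pick c A x w → x ∈ A
Pick-∈ (direct x∈ _ _) = x∈
Pick-∈ (wrapped x∈ _ _) = x∈

Pick⇒pick : ∀ {c A x w} → Sorted A → Pick c A x w → pick c A ≡ just (x , w)
Pick⇒pick {c} {A} sA p with pick c A | pickView c sA
... | nothing | none refl with () ← Pick-∈ p
... | just _ | some q = cong just (Pick-functional q p)

-- All conditions except membership quantify over the free balls, so they persist when the row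
-- shrinks; `x ≢ y` keeps the membership.
Pick-removeCol : ∀ {c A x w y} → Pick c A x w → x ≢ y → Pick c (removeCol y A) x w
Pick-removeCol {A = A} (direct x∈ c≤x lx) x≢y =
  direct (∈-removeCol⁺ x∈ x≢y) c≤x (λ z∈ → lx (proj₁ (∈-removeCol⁻ A z∈)))
Pick-removeCol {A = A} (wrapped x∈ ub lx) x≢y =
  wrapped (∈-removeCol⁺ x∈ x≢y) (λ z∈ → ub (proj₁ (∈-removeCol⁻ A z∈))) (λ z∈ → lx (proj₁ (∈-removeCol⁻ A z∈)))

-- If two balls compete for x, the loser takes the cyclic successor y of x,
-- whichever ball it is, and the wraps are the same up to order.
Pick-compete : ∀ {c c' A x y y' w w' v v'} → Pick c A x w → Pick c' A x w' →
  Pick c (removeCol x A) y v → Pick c' (removeCol x A) y' v' →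
  y ≡ y' × ((w ≡ w' × v ≡ v') ⊎ (w ≡ v × w' ≡ v'))
Pick-compete {A = A} (direct _ c≤x lx) (direct _ c'≤x lx') (direct y∈ c≤y ly) (direct y'∈ c'≤y' ly') =
  ≤-antisym (ly y'∈ (≤-trans c≤x (lx' (proj₁ (∈-removeCol⁻ A y'∈)) c'≤y')))
            (ly' y∈ (≤-trans c'≤x (lx (proj₁ (∈-removeCol⁻ A y∈)) c≤y))) , inj₁ (refl , refl)
Pick-compete {A = A} (direct _ c≤x lx) (direct _ c'≤x lx') (direct y∈ c≤y ly) (wrapped y'∈ ub' ly') =
  ⊥-elim (<⇒≱ (ub' y∈) (≤-trans c'≤x (lx (proj₁ (∈-removeCol⁻ A y∈)) c≤y)))
Pick-compete {A = A} (direct _ c≤x lx) (direct _ c'≤x lx') (wrapped y∈ ub ly) (direct y'∈ c'≤y' ly') =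
  ⊥-elim (<⇒≱ (ub y'∈) (≤-trans c≤x (lx' (proj₁ (∈-removeCol⁻ A y'∈)) c'≤y')))
Pick-compete (direct _ _ _) (direct _ _ _) (wrapped y∈ _ ly) (wrapped y'∈ _ ly') =
  ≤-antisym (ly y'∈) (ly' y∈) , inj₁ (refl , refl)
Pick-compete {A = A} (direct _ c≤x _) (wrapped _ _ lx) (direct y∈ _ ly) (wrapped y'∈ _ ly') =
  ≤-antisym (ly y'∈ (≤-trans c≤x (lx (proj₁ (∈-removeCol⁻ A y'∈))))) (ly' y∈) , inj₂ (refl , refl)
Pick-compete {A = A} (direct _ c≤x _) (wrapped _ _ lx) (wrapped y∈ ub _) _ =
  ⊥-elim (<⇒≱ (ub y∈) (≤-trans c≤x (lx (proj₁ (∈-removeCol⁻ A y∈)))))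
Pick-compete {A = A} (direct _ _ _) (wrapped _ ub _) _ (direct y'∈ c'≤y' _) =
  ⊥-elim (<⇒≱ (ub (proj₁ (∈-removeCol⁻ A y'∈))) c'≤y')
Pick-compete {A = A} (wrapped _ _ lx) (direct _ c≤x _) (wrapped y'∈ _ ly') (direct y∈ _ ly) =
  ≤-antisym (ly' y∈) (ly y'∈ (≤-trans c≤x (lx (proj₁ (∈-removeCol⁻ A y'∈))))) , inj₂ (refl , refl)
Pick-compete {A = A} (wrapped _ _ lx) (direct _ c≤x _) _ (wrapped y∈ ub _) =
  ⊥-elim (<⇒≱ (ub y∈) (≤-trans c≤x (lx (proj₁ (∈-removeCol⁻ A y∈)))))
Pick-compete {A = A} (wrapped _ ub _) _ (direct y∈ c≤y _) _ =
  ⊥-elim (<⇒≱ (ub (proj₁ (∈-removeCol⁻ A y∈))) c≤y)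
Pick-compete {A = A} (wrapped _ _ _) (wrapped _ ub _) _ (direct y'∈ c'≤y' _) =
  ⊥-elim (<⇒≱ (ub (proj₁ (∈-removeCol⁻ A y'∈))) c'≤y')
Pick-compete (wrapped _ _ _) (wrapped _ _ _) (wrapped y∈ _ ly) (wrapped y'∈ _ ly') =
  ≤-antisym (ly y'∈) (ly' y∈) , inj₁ (refl , refl)

-- Reordering balls of equal label.

infix 4 _≋_

-- Permutations generated by exchanging neighbours of equal label. Balls of different labels keep
-- their relative order, on which the pairing does depend.
data _≋_ : List (ℕ × ℕ) → List (ℕ × ℕ) → Set where
  ≋-refl  : ∀ {xs} → xs ≋ xs
  ≋-prep  : ∀ b {xs ys} → xs ≋ ys → b ∷ xs ≋ b ∷ ys
  ≋-swap  : ∀ c c' l {xs} → (c , l) ∷ (c' , l) ∷ xs ≋ (c' , l) ∷ (c , l) ∷ xs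
  ≋-trans : ∀ {xs ys zs} → xs ≋ ys → ys ≋ zs → xs ≋ zs

≋-++ʳ : ∀ {xs ys} zs → xs ≋ ys → xs ++ zs ≋ ys ++ zs
≋-++ʳ zs ≋-refl = ≋-refl
≋-++ʳ zs (≋-prep b e) = ≋-prep b (≋-++ʳ zs e)
≋-++ʳ zs (≋-swap c c' l) = ≋-swap c c' l
≋-++ʳ zs (≋-trans e f) = ≋-trans (≋-++ʳ zs e) (≋-++ʳ zs f)

Desc : List (ℕ × ℕ) → Set
Desc = AllPairs (λ a b → proj₂ b ≤ proj₂ a)

bubble : ∀ b {xs ys} → All (λ e → proj₂ e ≡ proj₂ b) xs → b ∷ xs ++ ys ≋ xs ++ b ∷ ys
bubble b [] = ≋-refl
bubble (c , l) {(c' , _) ∷ xs} (refl ∷ h) = ≋-trans (≋-swap c c' l) (≋-prep _ (bubble _ h))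

AllPairs-drop-mid : ∀ {R : A → A → Set} xs {y ys} → AllPairs R (xs ++ y ∷ ys) →
  All (λ x → R x y) xs × AllPairs R (xs ++ ys)
AllPairs-drop-mid [] (_ ∷ h) = [] , h
AllPairs-drop-mid (x ∷ xs) (hx ∷ h) with AllPairs-drop-mid xs h | Allₚ.++⁻ xs hx
... | r , rs | hxs , (hy ∷ hys) = hy ∷ r , Allₚ.++⁺ hxs hys ∷ rs

-- The head `x` of the first list occurs somewhere in the second. Whatever precedes it there has a
-- label at least that of `x` because the second list descends, and at most that of `x` because `x`
-- heads the first. So these labels are equal and `x` can move to the front.
Desc-↭⇒≋ : ∀ {xs ys} → Desc xs → Desc ys → xs ↭ ys → xs ≋ ys
Desc-↭⇒≋ {[]} _ _ σ rewrite ↭-empty-inv (↭-sym σ) = ≋-refl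
Desc-↭⇒≋ {x ∷ xs} (hx ∷ dxs) dys σ with ∈-∃++ (∈-resp-↭ σ (here refl))
... | ys₁ , ys₂ , refl with AllPairs-drop-mid ys₁ dys
...   | ≥x , dys' = ≋-trans (≋-prep x (Desc-↭⇒≋ dxs dys' (drop-mid [] ys₁ σ)))
                            (bubble x (All.zipWith (λ (p , q) → ≤-antisym p q) (≤x , ≥x)))
  where
  ≤x : All (λ e → proj₂ e ≤ proj₂ x) ys₁
  ≤x = Allₚ.++⁻ˡ ys₁ (All-resp-↭ σ (≤-refl ∷ hx))

insDesc-↭ : ∀ b xs → insDesc b xs ↭ b ∷ xs
insDesc-↭ b [] = ↭-refl
insDesc-↭ (c , l) ((c' , l') ∷ xs) with l' <ᵇ l
... | true = ↭-refl
... | false = ↭-trans (prep _ (insDesc-↭ (c , l) xs)) (swap _ _ ↭-refl)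

insDesc-Desc : ∀ b {xs} → Desc xs → Desc (insDesc b xs)
insDesc-Desc b [] = [] ∷ []
insDesc-Desc (c , l) {(c' , l') ∷ xs} (h ∷ d) with l' <ᵇ l in eq
... | true = (l'≤l ∷ All.map (λ p → ≤-trans p l'≤l) h) ∷ h ∷ d
  where l'≤l = <⇒≤ (<ᵇ⇒< l' l (≡true⇒T eq))
... | false = All-resp-↭ (↭-sym (insDesc-↭ (c , l) xs)) (≮⇒≥ (≡false⇒¬T eq ∘ <⇒<ᵇ) ∷ h) ∷ insDesc-Desc (c , l) d

foldl-insDesc : ∀ acc bs → Desc acc →
  Desc (foldl (λ acc b → insDesc b acc) acc bs) × foldl (λ acc b → insDesc b acc) acc bs ↭ bs ++ acc
foldl-insDesc acc [] d = d , ↭-refl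
foldl-insDesc acc (b ∷ bs) d with foldl-insDesc (insDesc b acc) bs (insDesc-Desc b d)
... | d' , σ = d' , ↭-trans σ (↭-trans (Permₚ.++⁺ˡ bs (insDesc-↭ b acc)) (Permₚ.shift b bs acc))

processOrder-Desc : ∀ bs → Desc (processOrder bs)
processOrder-Desc bs = proj₁ (foldl-insDesc [] bs [])

processOrder-↭ : ∀ bs → processOrder bs ↭ bs
processOrder-↭ bs with foldl-insDesc [] bs []
... | _ , σ = ↭-trans σ (↭-reflexive (++-identityʳ bs))

-- Pairing a row in another order.

wrapWt : ℕ → ℕ → Bool → ℕ
wrapWt r l w = if w then (l + 1) ∸ r else 0

_≋²_ : List (ℕ × ℕ) × ℕ → List (ℕ × ℕ) × ℕ → Set
p ≋² q = proj₁ p ≋ proj₁ q × proj₂ p ≡ proj₂ q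

length-removeCol : ∀ {x xs} → Sorted xs → x ∈ xs → length xs ≡ suc (length (removeCol x xs))
length-removeCol sxs x∈xs = Permₚ.↭-length (↭-removeCol sxs x∈xs)

-- There must be room for all balls: if only one free ball is left, then
-- whether the last pairing wraps depends on which of the two balls gets it.
pairRow-swap : ∀ r c c' l bs {A} → Sorted A → 2 + length bs ≤ length A →
  pairRow r ((c , l) ∷ (c' , l) ∷ bs) A ≋² pairRow r ((c' , l) ∷ (c , l) ∷ bs) A
pairRow-swap r c c' l bs {A} sA room
  with pick c A | pickView c sA | pick c' A | pickView c' sA
... | nothing | none refl | _ | _ with () ← room
... | just _ | some p | nothing | none refl with () ← room
... | just (x , w) | some p | just (x' , w') | some p' with x ≟ x'
... | no x≢x'
    rewrite Pick⇒pick (removeCol-Sorted sA) (Pick-removeCol p' (x≢x' ∘ sym))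
          | Pick⇒pick (removeCol-Sorted sA) (Pick-removeCol p x≢x')
          | removeCol-comm x x' A
    = ≋-swap x x' l , x∙yz≈y∙xz (wrapWt r l w) (wrapWt r l w') _
... | yes refl with pick c (removeCol x A) | pickView c (removeCol-Sorted {x} sA)
                  | pick c' (removeCol x A) | pickView c' (removeCol-Sorted {x} sA)
...   | nothing | none e | _ | _
        with s≤s () ← subst (_ ≤_) (trans (length-removeCol sA (Pick-∈ p)) (cong (suc ∘ length) e)) room
...   | just _ | some q | nothing | none e with () ← subst (_ ∈_) e (Pick-∈ q)
...   | just (y , v) | some q | just (y' , v') | some q' with Pick-compete p p' q q'
...     | refl , inj₁ (refl , refl) = ≋-refl , refl
...     | refl , inj₂ (refl , refl) = ≋-refl , x∙yz≈y∙xz (wrapWt r l w) (wrapWt r l w') _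

≋-length : ∀ {xs ys} → xs ≋ ys → length xs ≡ length ys
≋-length ≋-refl = refl
≋-length (≋-prep b e) = cong suc (≋-length e)
≋-length (≋-swap c c' l) = refl
≋-length (≋-trans e f) = trans (≋-length e) (≋-length f)

-- Each pairing uses up one ball and one free site, so the room needed for `pairRow-swap` is still
-- there when the exchange happens further down the list.
pairRow-≋ : ∀ r {bs bs'} → bs ≋ bs' → ∀ {A} → Sorted A → length bs ≤ length A → pairRow r bs A ≋² pairRow r bs' A
pairRow-≋ r ≋-refl sA room = ≋-refl , refl
pairRow-≋ r (≋-trans e f) sA room with pairRow-≋ r e sA room | pairRow-≋ r f sA (subst (_≤ _) (≋-length e) room)
... | e₁ , e₂ | f₁ , f₂ = ≋-trans e₁ f₁ , trans e₂ f₂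
pairRow-≋ r (≋-swap c c' l) sA room = pairRow-swap r c c' l _ sA room
pairRow-≋ r (≋-prep (c , l) e) {A} sA room with pick c A | pickView c sA
... | nothing | none refl with () ← room
... | just (x , w) | some p
  with pairRow-≋ r e (removeCol-Sorted {x} sA) (≤-pred (subst (_ ≤_) (length-removeCol sA (Pick-∈ p)) room))
... | e₁ , e₂ = ≋-prep (x , l) e₁ , cong (wrapWt r l w +_) e₂

-- Labelling without sorting.

-- Membership of the labelled columns in the row and their distinctness in one condition, in the
-- recursive shape in which `pairRow` consumes free sites.
Fits : List ℕ → List (ℕ × ℕ) → Set
Fits row [] = ⊤
Fits row ((c , _) ∷ lab) = c ∈ row × Fits (removeCol c row) lab

pairRow-Fits : ∀ r bs {A} → Sorted A → Fits A (proj₁ (pairRow r bs A))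
pairRow-Fits r [] sA = tt
pairRow-Fits r ((c , l) ∷ bs) {A} sA with pick c A | pickView c sA
... | nothing | _ = pairRow-Fits r bs sA
... | just (x , w) | some p = Pick-∈ p , pairRow-Fits r bs (removeCol-Sorted sA)

pairRow-All : ∀ {P : ℕ → Set} r bs {A} → All (P ∘ proj₂) bs → All (P ∘ proj₂) (proj₁ (pairRow r bs A))
pairRow-All r [] [] = []
pairRow-All r ((c , l) ∷ bs) {A} (h ∷ hs) with pick c A
... | nothing = pairRow-All r bs hs
... | just _ = h ∷ pairRow-All r bs hs

pairRow-Desc : ∀ r bs {A} → Desc bs → Desc (proj₁ (pairRow r bs A))
pairRow-Desc r [] [] = []
pairRow-Desc r ((c , l) ∷ bs) {A} (h ∷ hs) with pick c A
... | nothing = pairRow-Desc r bs hs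
... | just _ = pairRow-All r bs h ∷ pairRow-Desc r bs hs

unlabelled : List ℕ → List (ℕ × ℕ) → List ℕ
unlabelled row [] = row
unlabelled row ((c , _) ∷ lab) = unlabelled (removeCol c row) lab

unlabelled-≋ : ∀ row {lab lab'} → lab ≋ lab' → unlabelled row lab ≡ unlabelled row lab'
unlabelled-≋ row ≋-refl = refl
unlabelled-≋ row (≋-prep b e) = unlabelled-≋ _ e
unlabelled-≋ row (≋-swap c c' l {xs}) = cong (λ z → unlabelled z xs) (removeCol-comm c' c row)
unlabelled-≋ row (≋-trans e f) = trans (unlabelled-≋ row e) (unlabelled-≋ row f)

-- Under `LabelInv` the inherited labels descend and are at least `r`, so appending the new balls
-- with label `r` already gives an order of decreasing labels.
queue : ℕ → List (ℕ × ℕ) → List ℕ → List (ℕ × ℕ)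
queue r lab row = lab ++ map (_, r) (unlabelled row lab)

-- The major index computed without sorting: within a row, balls are served
-- in the order in which their strands were started.
strandMaj : ℕ → List (ℕ × ℕ) → List (List ℕ) → ℕ
strandMaj r lab [] = 0
strandMaj r lab (row ∷ []) = 0
strandMaj r lab (row ∷ rest@(next ∷ _)) =
  let res = pairRow r (queue r lab row) next
  in proj₂ res + strandMaj (r ∸ 1) (proj₁ res) rest

labelOf-skip : ∀ {c c' l lab r} → c ≢ c' → labelOf c' ((c , l) ∷ lab) r ≡ labelOf c' lab r
labelOf-skip {c} {c'} c≢c' rewrite ¬T⇒≡false (c≢c' ∘ ≡ᵇ⇒≡ c c') = refl

-- By `Fits`, the column of the first labelled ball can be split off from the row. The remaining
-- columns differ from it, so their label lookups skip its entry and the induction hypothesis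
-- applies.
labelled-↭-queue : ∀ r lab {row} → Sorted row → Fits row lab →
  map (λ c → c , labelOf c lab r) row ↭ queue r lab row
labelled-↭-queue r [] srow _ = ↭-refl
labelled-↭-queue r ((c , l) ∷ lab) {row} srow (c∈ , fits) =
  ↭-trans (Permₚ.map⁺ _ (↭-removeCol srow c∈)) (lem (labelled-↭-queue r lab (removeCol-Sorted srow) fits))
  where
  rest-eq : map (λ c' → c' , labelOf c' ((c , l) ∷ lab) r) (removeCol c row) ≡ map (λ c' → c' , labelOf c' lab r) (removeCol c row)
  rest-eq = map-cong-local (All.tabulate λ {c'} c'∈ →
    cong (c' ,_) (labelOf-skip {lab = lab} (proj₂ (∈-removeCol⁻ row c'∈) ∘ sym)))
  lem : ∀ {ys} → map (λ c' → c' , labelOf c' lab r) (removeCol c row) ↭ ys →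
    (c , labelOf c ((c , l) ∷ lab) r) ∷ map (λ c' → c' , labelOf c' ((c , l) ∷ lab) r) (removeCol c row) ↭ (c , l) ∷ ys
  lem σ rewrite T⇒≡true (≡⇒≡ᵇ c c refl) | rest-eq = prep _ σ

record LabelInv (r : ℕ) (lab : List (ℕ × ℕ)) : Set where
  field
    desc : Desc lab
    ≥row : All (λ e → r ≤ proj₂ e) lab
open LabelInv

queue-Desc : ∀ {r lab} row → LabelInv r lab → Desc (queue r lab row)
queue-Desc {r} {lab} row inv = AllPairsₚ.++⁺ (desc inv)
  (const-Desc (unlabelled row lab))
  (All.map (λ r≤ → Allₚ.map⁺ (All.universal (λ _ → r≤) _)) (≥row inv))
  where
  const-Desc : ∀ xs → Desc (map (_, r) xs)
  const-Desc [] = []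
  const-Desc (x ∷ xs) = Allₚ.map⁺ (All.universal (λ _ → ≤-refl) xs) ∷ const-Desc xs

queue-≥ : ∀ {r lab} row → LabelInv r lab → All (λ e → r ≤ proj₂ e) (queue r lab row)
queue-≥ row inv = Allₚ.++⁺ (≥row inv) (Allₚ.map⁺ (All.universal (λ _ → ≤-refl) _))

Growing : List (List ℕ) → Set
Growing = Linked (λ a b → length a ≤ length b)

-- Both procedures run down the rows in parallel, with labelled balls that agree only up to `≋`;
-- hence two lists `lab` and `lab'`. Growing rows supply the room that `pairRow-≋` asks for.
fmMaj≡strandMaj : ∀ r {lab lab'} row rest → lab ≋ lab' → LabelInv r lab → Fits row lab →
  All Sorted (row ∷ rest) → Growing (row ∷ rest) →
  fmMaj r lab (row ∷ rest) ≡ strandMaj r lab' (row ∷ rest)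
fmMaj≡strandMaj r row [] _ _ _ _ _ = refl
fmMaj≡strandMaj r {lab} {lab'} row (next ∷ rest) e inv fits (srow ∷ snext ∷ srest) (row≤next ∷ grow) =
  cong₂ _+_ (proj₂ res) (fmMaj≡strandMaj (r ∸ 1) next rest (proj₁ res) inv' (pairRow-Fits r balls snext) (snext ∷ srest) grow)
  where
  labelled = map (λ c → c , labelOf c lab r) row
  balls = processOrder labelled
  perm : balls ↭ queue r lab row
  perm = ↭-trans (processOrder-↭ labelled) (labelled-↭-queue r lab srow fits)
  -- The sorted balls and `queue r lab row` are descending permutations of each other; afterwards
  -- `lab` is exchanged for `lab'`.
  order : balls ≋ queue r lab' row
  order = ≋-trans (Desc-↭⇒≋ (processOrder-Desc labelled) (queue-Desc row inv) perm)
    (subst (λ u → queue r lab row ≋ lab' ++ map (_, r) u) (unlabelled-≋ row e) (≋-++ʳ _ e))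
  room : length balls ≤ length next
  room = subst (_≤ length next) (sym (trans (Permₚ.↭-length (processOrder-↭ labelled)) (length-map _ row))) row≤next
  res : pairRow r balls next ≋² pairRow r (queue r lab' row) next
  res = pairRow-≋ r order snext room
  inv' : LabelInv (r ∸ 1) (proj₁ (pairRow r balls next))
  inv' .desc = pairRow-Desc r balls (processOrder-Desc labelled)
  inv' .≥row = pairRow-All r balls (All.map (≤-trans (m∸n≤m r 1)) (All-resp-↭ (↭-sym perm) (queue-≥ row inv)))

-- Following and removing one strand.

strandWt : ℕ → ℕ → ℕ → List (List ℕ) → ℕ
strandWt l r c [] = 0
strandWt l r c (next ∷ rest) with pick c next
... | nothing = 0
... | just (x , w) = wrapWt r l w + strandWt l (r ∸ 1) x rest

removeStrand : ℕ → List (List ℕ) → List (List ℕ)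
removeStrand c [] = []
removeStrand c (next ∷ rest) with pick c next
... | nothing = next ∷ rest
... | just (x , w) = removeCol x next ∷ removeStrand x rest

-- The first labelled ball is served first, and its partner heads the labelled balls of the next
-- row. So its strand sees every row untouched, and all other balls see the rows with that strand
-- removed. Nonempty rows ensure that the strand reaches row 1.
peel : ∀ r c l lab row rest → All (_≢ []) rest → All Sorted rest →
  strandMaj r ((c , l) ∷ lab) (row ∷ rest) ≡
  strandWt l r c rest + strandMaj r lab (removeCol c row ∷ removeStrand c rest)
peel r c l lab row [] _ _ = refl
peel r c l lab row (next ∷ rest) (next≢[] ∷ ne) (snext ∷ srest) with pick c next | pickView c snext
... | nothing | none e = ⊥-elim (next≢[] e)
... | just (x , w) | some _
  rewrite peel (r ∸ 1) x l (proj₁ (pairRow r (queue r lab (removeCol c row)) (removeCol x next))) next rest ne srest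
  -- Separates the strand's share from that of the other balls, both in this row and below.
  = interchange (wrapWt r l w) _ (strandWt l (r ∸ 1) x rest) _

strandMaj-[] : ∀ r rest → strandMaj r [] ([] ∷ rest) ≡ strandMaj (r ∸ 1) [] rest
strandMaj-[] r [] = refl
strandMaj-[] r (_ ∷ _) = refl

-- As an unlabelled ball, the leftmost one would be served first with label `r` anyway. Listing it
-- as labelled makes `peel` applicable.
strandMaj-start : ∀ r c row rest → All (c <_) row →
  strandMaj r [] ((c ∷ row) ∷ rest) ≡ strandMaj r ((c , r) ∷ []) ((c ∷ row) ∷ rest)
strandMaj-start r c row [] _ = refl
strandMaj-start r c row (next ∷ rest) h rewrite removeCol-head h = refl

-- Accessible forms of `positioned` and `nextOcc`.

numbered : ℕ → List ℕ → List (ℕ × ℕ)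
numbered i [] = []
numbered i (x ∷ xs) = (i , x) ∷ numbered (suc i) xs

-- The counting loop of positioned is a local function of Defs and cannot be
-- named here.  Generalising its arguments to variables lets unification solve
-- the underscore in go≡numbered with that loop.
mutual
  positioned≡numbered : ∀ w → positioned w ≡ numbered 0 w
  positioned≡numbered [] = refl
  positioned≡numbered (x ∷ xs) with x ∷ xs | 1
  ... | v | n = cong ((0 , x) ∷_) (go≡numbered v n xs)

  go≡numbered : ∀ v i xs → _ ≡ numbered i xs
  go≡numbered v i [] = refl
  go≡numbered v i (x ∷ xs) = cong ((i , x) ∷_) (go≡numbered v (suc i) xs)

after : ℕ → ℕ → ℕ × ℕ → Bool
after m cur e = (proj₂ e ≡ᵇ m) ∧ (cur <ᵇ proj₁ e)

firstPos : List (ℕ × ℕ) → Maybe ℕ → Maybe ℕ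
firstPos [] d = d
firstPos (e ∷ _) d = just (proj₁ e)

-- Same device for nextOcc.  K stands for the fallback search from the start of
-- the word; being a variable, it does not reduce when a ∷ xs is generalised.
mutual
  nextOcc-eq : ∀ m cur w (K : List (ℕ × ℕ) → Maybe ℕ) → (∀ v → K v ≡ firstPos (filterᵇ (λ e → proj₂ e ≡ᵇ m) v) nothing) →
    nextOcc m cur w ≡ firstPos (filterᵇ (after m cur) w) (K w)
  nextOcc-eq m cur [] K h = sym (h [])
  nextOcc-eq m cur (a ∷ xs) K h with a ∷ xs | proj₂ a ≡ᵇ m | cur <ᵇ proj₁ a
  ... | v | true | true = refl
  ... | v | true | false = nextOcc-go m cur v xs K h
  ... | v | false | _ = nextOcc-go m cur v xs K h

  nextOcc-go : ∀ m cur v xs (K : List (ℕ × ℕ) → Maybe ℕ) → (∀ v → K v ≡ firstPos (filterᵇ (λ e → proj₂ e ≡ᵇ m) v) nothing) →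
    _ ≡ firstPos (filterᵇ (after m cur) xs) (K v)
  nextOcc-go m cur v [] K h rewrite h v with filterᵇ (λ e → proj₂ e ≡ᵇ m) v
  ... | [] = refl
  ... | _ ∷ _ = refl
  nextOcc-go m cur v (a ∷ xs) K h with proj₂ a ≡ᵇ m | cur <ᵇ proj₁ a
  ... | true | true = refl
  ... | true | false = nextOcc-go m cur v xs K h
  ... | false | _ = nextOcc-go m cur v xs K h

-- Boolean filters and ordered lists.

T-ext : ∀ {a b} → (T a → T b) → (T b → T a) → a ≡ b
T-ext {false} {false} _ _ = refl
T-ext {false} {true} _ g = ⊥-elim (g tt)
T-ext {true} {false} f _ = ⊥-elim (f tt)
T-ext {true} {true} _ _ = refl

filterᵇ-map : (p : B → Bool) (f : A → B) (xs : List A) → filterᵇ p (map f xs) ≡ map f (filterᵇ (p ∘ f) xs)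
filterᵇ-map p f [] = refl
filterᵇ-map p f (x ∷ xs) with p (f x)
... | true = cong (f x ∷_) (filterᵇ-map p f xs)
... | false = filterᵇ-map p f xs

filterᵇ-∧ : (p q : A → Bool) (xs : List A) → filterᵇ p (filterᵇ q xs) ≡ filterᵇ (λ x → q x ∧ p x) xs
filterᵇ-∧ p q [] = refl
filterᵇ-∧ p q (x ∷ xs) with q x
... | false = filterᵇ-∧ p q xs
... | true with p x
...   | true = cong (x ∷_) (filterᵇ-∧ p q xs)
...   | false = filterᵇ-∧ p q xs

filterᵇ-cong-∈ : {p q : A → Bool} (xs : List A) → (∀ {x} → x ∈ xs → p x ≡ q x) → filterᵇ p xs ≡ filterᵇ q xs
filterᵇ-cong-∈ [] h = refl
filterᵇ-cong-∈ {p = p} {q} (x ∷ xs) h with p x | q x | h (here refl)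
... | true | true | _ = cong (x ∷_) (filterᵇ-cong-∈ xs (h ∘ there))
... | false | false | _ = filterᵇ-cong-∈ xs (h ∘ there)

∈-filterᵇ⁺ : (p : A → Bool) {x : A} {xs : List A} → x ∈ xs → T (p x) → x ∈ filterᵇ p xs
∈-filterᵇ⁺ p = ∈-filter⁺ (T? ∘ p)

∈-filterᵇ⁻ : (p : A → Bool) {x : A} (xs : List A) → x ∈ filterᵇ p xs → x ∈ xs × T (p x)
∈-filterᵇ⁻ p xs = ∈-filter⁻ (T? ∘ p) {xs = xs}

AllPairs-map-∈ : ∀ {R S : A → A → Set} {xs} → (∀ {x y} → x ∈ xs → y ∈ xs → R x y → S x y) → AllPairs R xs → AllPairs S xs
AllPairs-map-∈ h [] = []
AllPairs-map-∈ h (r ∷ rs) = All.tabulate (λ y∈ → h (here refl) (there y∈) (All.lookup r y∈)) ∷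
  AllPairs-map-∈ (λ x∈ y∈ → h (there x∈) (there y∈)) rs

AllPairs-total : ∀ {R : A → A → Set} {xs x y} → AllPairs R xs → x ∈ xs → y ∈ xs → x ≡ y ⊎ R x y ⊎ R y x
AllPairs-total (r ∷ rs) (here refl) (here refl) = inj₁ refl
AllPairs-total (r ∷ rs) (here refl) (there y∈) = inj₂ (inj₁ (All.lookup r y∈))
AllPairs-total (r ∷ rs) (there x∈) (here refl) = inj₂ (inj₂ (All.lookup r x∈))
AllPairs-total (r ∷ rs) (there x∈) (there y∈) = AllPairs-total rs x∈ y∈

memb⇒∈ : ∀ {x} ys → T (memb x ys) → x ∈ ys
memb⇒∈ {x} (y ∷ ys) t with y ≡ᵇ x in eq
... | true = here (sym (≡ᵇ⇒≡ y x (≡true⇒T eq)))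
... | false = there (memb⇒∈ ys t)

∈⇒memb : ∀ {x ys} → x ∈ ys → T (memb x ys)
∈⇒memb {x} {y ∷ ys} x∈ with y ≡ᵇ x in eq
... | true = tt
∈⇒memb {x} {y ∷ ys} (here refl) | false = ⊥-elim (≡false⇒¬T eq (≡⇒≡ᵇ x x refl))
∈⇒memb {x} {y ∷ ys} (there x∈) | false = ∈⇒memb x∈

-- Both searches in terms of filtered lists.

pick-direct : ∀ c A {x xs} → filterᵇ (λ x → c <ᵇ suc x) A ≡ x ∷ xs → pick c A ≡ just (x , false)
pick-direct c A e rewrite e = refl

pick-wrapped : ∀ c A {x xs} → filterᵇ (λ x → c <ᵇ suc x) A ≡ [] → A ≡ x ∷ xs → pick c A ≡ just (x , true)
pick-wrapped c A e refl rewrite e = refl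

nextOcc-right : ∀ m cur w {e es} → filterᵇ (after m cur) w ≡ e ∷ es → nextOcc m cur w ≡ just (proj₁ e)
nextOcc-right m cur w eq =
  trans (nextOcc-eq m cur w (λ v → firstPos (filterᵇ (λ e → proj₂ e ≡ᵇ m) v) nothing) (λ _ → refl))
        (cong (λ v → firstPos v _) eq)

nextOcc-left : ∀ m cur w {e es} → filterᵇ (after m cur) w ≡ [] → filterᵇ (λ e → proj₂ e ≡ᵇ m) w ≡ e ∷ es →
  nextOcc m cur w ≡ just (proj₁ e)
nextOcc-left m cur w eq eo =
  trans (nextOcc-eq m cur w (λ v → firstPos (filterᵇ (λ e → proj₂ e ≡ᵇ m) v) nothing) (λ _ → refl))
        (cong₂ (λ v u → firstPos v (firstPos u nothing)) eq eo)

-- Chains of letters and the charge of a standard subword.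

occ : ℕ → List (ℕ × ℕ) → List (ℕ × ℕ)
occ j = filterᵇ (λ e → proj₂ e ≡ᵇ j)

-- One occurrence in `w` of each letter from `m` down to 1: the shape of a choice made by
-- `chooseFrom`, with the letters kept beside the positions.
data Chain (w : List (ℕ × ℕ)) : ℕ → List (ℕ × ℕ) → Set where
  []  : Chain w 0 []
  _∷_ : ∀ {q m es} → (q , suc m) ∈ w → Chain w m es → Chain w (suc m) ((q , suc m) ∷ es)

-- The weight of a strand of label `l`, read off positions: `p` is the letter chosen before, and a
-- step to a smaller position counts as a wrap. The pairing that reaches letter `j` starts in row
-- `suc j`.
chainWt : ℕ → ℕ → List (ℕ × ℕ) → ℕ
chainWt l p [] = 0
chainWt l p ((q , j) ∷ es) = wrapWt (suc j) l (q <ᵇ p) + chainWt l q es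

chain-⊆ : ∀ {w m es e} → Chain w m es → e ∈ es → e ∈ w
chain-⊆ (q∈ ∷ ch) (here refl) = q∈
chain-⊆ (q∈ ∷ ch) (there e∈) = chain-⊆ ch e∈

chain-letter≤ : ∀ {w m es e} → Chain w m es → e ∈ es → proj₂ e ≤ m
chain-letter≤ (q∈ ∷ ch) (here refl) = ≤-refl
chain-letter≤ (q∈ ∷ ch) (there e∈) = m≤n⇒m≤1+n (chain-letter≤ ch e∈)

chain-letter-injective : ∀ {w m es e e'} → Chain w m es → e ∈ es → e' ∈ es → proj₂ e ≡ proj₂ e' → e ≡ e'
chain-letter-injective (_ ∷ ch) (here refl) (here refl) _ = refl
chain-letter-injective (_ ∷ ch) (here refl) (there e'∈) eq = ⊥-elim (<⇒≱ (s≤s (chain-letter≤ ch e'∈)) (≤-reflexive eq))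
chain-letter-injective (_ ∷ ch) (there e∈) (here refl) eq = ⊥-elim (<⇒≱ (s≤s (chain-letter≤ ch e∈)) (≤-reflexive (sym eq)))
chain-letter-injective (_ ∷ ch) (there e∈) (there e'∈) eq = chain-letter-injective ch e∈ e'∈ eq

chain-Unique : ∀ {w m es} → Chain w m es → Unique es
chain-Unique [] = []
chain-Unique (_ ∷ ch) = All.tabulate (λ e∈ eq → <⇒≱ (s≤s (chain-letter≤ ch e∈)) (≤-reflexive (cong proj₂ eq))) ∷ chain-Unique ch

chain-length : ∀ {w m es} → Chain w m es → length es ≡ m
chain-length [] = refl
chain-length (_ ∷ ch) = cong suc (chain-length ch)

onChain : List (ℕ × ℕ) → ℕ × ℕ → Bool
onChain es e = memb (proj₁ e) (map proj₁ es)

∈⇒onChain : ∀ {es e} → e ∈ es → T (onChain es e)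
∈⇒onChain e∈ = ∈⇒memb (∈-map⁺ proj₁ e∈)

subword : List (ℕ × ℕ) → List (ℕ × ℕ) → List (ℕ × ℕ)
subword es w = filterᵇ (onChain es) w

remainder : List (ℕ × ℕ) → List (ℕ × ℕ) → List (ℕ × ℕ)
remainder es w = filterᵇ (λ e → if onChain es e then false else true) w

-- `chargePerm` compares indices within the subword, while chains record positions in the whole
-- word. Increasing positions and distinct letters make the two comparisons agree.
indexOf-pos : ∀ {V p q i j} → AllPairs (λ e e' → proj₁ e < proj₁ e') V →
  (∀ {e e'} → e ∈ V → e' ∈ V → proj₂ e ≡ proj₂ e' → e ≡ e') → i ≢ j →
  (p , i) ∈ V → (q , j) ∈ V → (indexOf i (map proj₂ V) <ᵇ indexOf j (map proj₂ V)) ≡ (p <ᵇ q)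
indexOf-pos {(r , a) ∷ V} {p} {q} {i} {j} (h ∷ hs) inj i≢j p∈ q∈ with a ≡ᵇ i in ei | a ≡ᵇ j in ej
... | true | true = ⊥-elim (i≢j (trans (sym (≡ᵇ⇒≡ a i (≡true⇒T ei))) (≡ᵇ⇒≡ a j (≡true⇒T ej))))
... | true | false with inj (here refl) p∈ (≡ᵇ⇒≡ a i (≡true⇒T ei)) | q∈
...   | refl | here refl = ⊥-elim (i≢j refl)
...   | refl | there q∈V = sym (T⇒≡true (<⇒<ᵇ (All.lookup h q∈V)))
indexOf-pos {(r , a) ∷ V} {p} {q} {i} {j} (h ∷ hs) inj i≢j p∈ q∈ | false | true
  with inj (here refl) q∈ (≡ᵇ⇒≡ a j (≡true⇒T ej)) | p∈
...   | refl | here refl = ⊥-elim (i≢j refl)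
...   | refl | there p∈V = sym (¬T⇒≡false (λ t → <-asym (All.lookup h p∈V) (<ᵇ⇒< p q t)))
indexOf-pos {(r , a) ∷ V} (h ∷ hs) inj i≢j (here refl) _ | false | false = ⊥-elim (≡false⇒¬T ei (≡⇒≡ᵇ a a refl))
indexOf-pos {(r , a) ∷ V} (h ∷ hs) inj i≢j (there _) (here refl) | false | false = ⊥-elim (≡false⇒¬T ej (≡⇒≡ᵇ a a refl))
indexOf-pos {(r , a) ∷ V} (h ∷ hs) inj i≢j (there p∈) (there q∈) | false | false =
  indexOf-pos hs (λ e∈ e'∈ → inj (there e∈) (there e'∈)) i≢j p∈ q∈

module _ (V : List (ℕ × ℕ)) (k : ℕ)
  (sV : AllPairs (λ e e' → proj₁ e < proj₁ e') V)
  (injV : ∀ {e e'} → e ∈ V → e' ∈ V → proj₂ e ≡ proj₂ e' → e ≡ e') where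

  ascentWt : ℕ → ℕ
  ascentWt i = if indexOf i (map proj₂ V) <ᵇ indexOf (suc i) (map proj₂ V) then k ∸ i else 0

  -- The charge sums over letters upwards whereas a chain descends, so the last term of the sum is
  -- split off to match the head of the chain.
  sum-ascents : ∀ {w m p es} → Chain w m es → (∀ {e} → e ∈ es → e ∈ V) → (p , suc m) ∈ V →
    sum (map ascentWt (applyUpTo suc m)) ≡ chainWt k p es
  sum-ascents [] _ _ = refl
  sum-ascents {m = suc m} {p} {(q , _) ∷ es} (q∈w ∷ ch) es⊆ p∈ = begin
    sum (map ascentWt (applyUpTo suc (suc m)))
      ≡⟨ cong (sum ∘ map ascentWt) (sym (applyUpTo-∷ʳ suc m)) ⟩
    sum (map ascentWt (applyUpTo suc m ++ suc m ∷ []))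
      ≡⟨ cong sum (map-++ ascentWt (applyUpTo suc m) (suc m ∷ [])) ⟩
    sum (map ascentWt (applyUpTo suc m) ++ ascentWt (suc m) ∷ [])
      ≡⟨ sum-++ (map ascentWt (applyUpTo suc m)) (ascentWt (suc m) ∷ []) ⟩
    sum (map ascentWt (applyUpTo suc m)) + (ascentWt (suc m) + 0)
      ≡⟨ cong₂ _+_ (sum-ascents ch (es⊆ ∘ there) q∈) (trans (+-identityʳ _) step) ⟩
    chainWt k q es + wrapWt (suc (suc m)) k (q <ᵇ p)
      ≡⟨ +-comm (chainWt k q es) _ ⟩
    wrapWt (suc (suc m)) k (q <ᵇ p) + chainWt k q es ∎
    where
    open ≡-Reasoning
    q∈ = es⊆ (here refl)
    -- With `i = suc m`, the wrap starts in row `i + 1`, and its weight `(k + 1) ∸ (i + 1)` is the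
    -- charge weight `k ∸ i`.
    step : ascentWt (suc m) ≡ wrapWt (suc (suc m)) k (q <ᵇ p)
    step = cong₂ (λ b x → if b then x else 0)
      (indexOf-pos sV injV (1+n≢n ∘ sym) q∈ p∈)
      (cong (_∸ suc (suc m)) (sym (+-comm k 1)))

-- Preliminaries to one round of charge.

maxLetter-≤ : ∀ {k w} → All (λ e → proj₂ e ≤ k) w → maxLetter w ≤ k
maxLetter-≤ [] = z≤n
maxLetter-≤ (h ∷ hs) = ⊔-lub h (maxLetter-≤ hs)

maxLetter-≥ : ∀ {e w} → e ∈ w → proj₂ e ≤ maxLetter w
maxLetter-≥ {e} (here refl) = m≤m⊔n _ _
maxLetter-≥ (there e∈) = ≤-trans (maxLetter-≥ e∈) (m≤n⊔m _ _)

firstChosen-eq : ∀ {w k e es} → maxLetter w ≡ suc k → occ (suc k) w ≡ e ∷ es →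
  firstChosen w ≡ proj₁ e ∷ chooseFrom k (proj₁ e) w
firstChosen-eq eqm eqo rewrite eqm | eqo = refl

nonempty-below : ∀ {x xs rs} → Growing ((x ∷ xs) ∷ rs) → All (_≢ []) rs
nonempty-below [-] = []
nonempty-below (_∷_ {y = []} () _)
nonempty-below (_∷_ {y = _ ∷ _} _ g) = (λ ()) ∷ nonempty-below g

chargeRounds-[] : ∀ f → chargeRounds f [] ≡ 0
chargeRounds-[] zero = refl
chargeRounds-[] (suc f) = chargeRounds-[] f

-- Words read column by column.

module _ (col : ℕ → ℕ) where

  -- col sends the positions of a word to columns of the queue; within a column
  -- the word lists the rows from top to bottom.
  Before : ℕ × ℕ → ℕ × ℕ → Set
  Before (p , a) (q , b) = p < q × (col p < col q ⊎ (col p ≡ col q × b < a))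

  ColumnWord : List (ℕ × ℕ) → Set
  ColumnWord = AllPairs Before

  row : ℕ → List (ℕ × ℕ) → List ℕ
  row j w = map (col ∘ proj₁) (occ j w)

  rows : ℕ → List (ℕ × ℕ) → List (List ℕ)
  rows zero w = []
  rows (suc m) w = row (suc m) w ∷ rows m w

  ∈-occ⁻ : ∀ {e} j w → e ∈ occ j w → e ∈ w × proj₂ e ≡ j
  ∈-occ⁻ j w e∈ with ∈-filterᵇ⁻ (λ e → proj₂ e ≡ᵇ j) w e∈
  ... | e∈w , t = e∈w , ≡ᵇ⇒≡ _ _ t

  ∈-occ⁺ : ∀ {p j w} → (p , j) ∈ w → (p , j) ∈ occ j w
  ∈-occ⁺ {j = j} e∈ = ∈-filterᵇ⁺ (λ e → proj₂ e ≡ᵇ j) e∈ (≡⇒≡ᵇ j j refl)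

  ∈-row : ∀ {p j w} → (p , j) ∈ w → col p ∈ row j w
  ∈-row e∈ = ∈-map⁺ (col ∘ proj₁) (∈-occ⁺ e∈)

  row-Sorted : ∀ j {w} → ColumnWord w → Sorted (row j w)
  row-Sorted j {w} cwd = AllPairsₚ.map⁺ (AllPairs-map-∈ strict (AllPairsₚ.filter⁺ _ cwd))
    where
    strict : ∀ {e e'} → e ∈ occ j w → e' ∈ occ j w → Before e e' → col (proj₁ e) < col (proj₁ e')
    strict _ _ (_ , inj₁ lt) = lt
    strict e∈ e'∈ (_ , inj₂ (_ , lt)) = ⊥-elim (<⇒≢ lt (trans (proj₂ (∈-occ⁻ j w e'∈)) (sym (proj₂ (∈-occ⁻ j w e∈)))))

  rows-Sorted : ∀ m {w} → ColumnWord w → All Sorted (rows m w)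
  rows-Sorted zero _ = []
  rows-Sorted (suc m) cwd = row-Sorted (suc m) cwd ∷ rows-Sorted m cwd

  pos-injective : ∀ {w e e'} → ColumnWord w → e ∈ w → e' ∈ w → proj₁ e ≡ proj₁ e' → e ≡ e'
  pos-injective cwd e∈ e'∈ eq with AllPairs-total cwd e∈ e'∈
  ... | inj₁ e≡ = e≡
  ... | inj₂ (inj₁ (lt , _)) = ⊥-elim (<⇒≢ lt eq)
  ... | inj₂ (inj₂ (lt , _)) = ⊥-elim (<⇒≢ lt (sym eq))

  site-injective : ∀ {w p q j} → ColumnWord w → (p , j) ∈ w → (q , j) ∈ w → col p ≡ col q → p ≡ q
  site-injective cwd e∈ e'∈ eq with AllPairs-total cwd e∈ e'∈
  ... | inj₁ refl = refl
  ... | inj₂ (inj₁ (_ , inj₁ lt)) = ⊥-elim (<⇒≢ lt eq)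
  ... | inj₂ (inj₁ (_ , inj₂ (_ , lt))) = ⊥-elim (<-irrefl refl lt)
  ... | inj₂ (inj₂ (_ , inj₁ lt)) = ⊥-elim (<⇒≢ lt (sym eq))
  ... | inj₂ (inj₂ (_ , inj₂ (_ , lt))) = ⊥-elim (<-irrefl refl lt)

  -- Columns are read from top to bottom, so a ball directly below comes later in the word. This
  -- turns the weak comparison of columns into a strict comparison of positions.
  weakly-right⇔after : ∀ {w p q m} → ColumnWord w → (p , suc m) ∈ w → (q , m) ∈ w → (col p <ᵇ suc (col q)) ≡ (p <ᵇ q)
  weakly-right⇔after {p = p} {q} cwd e∈ e'∈ with AllPairs-total cwd e∈ e'∈
  ... | inj₂ (inj₁ (p<q , le)) =
    trans (T⇒≡true (<⇒<ᵇ (s≤s (col≤ le)))) (sym (T⇒≡true (<⇒<ᵇ p<q)))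
    where
    col≤ : ∀ {X : Set} → col p < col q ⊎ (col p ≡ col q × X) → col p ≤ col q
    col≤ (inj₁ lt) = <⇒≤ lt
    col≤ (inj₂ (eq , _)) = ≤-reflexive eq
  ... | inj₂ (inj₂ (q<p , inj₁ lt)) =
    trans (¬T⇒≡false (λ t → <⇒≱ lt (≤-pred (<ᵇ⇒< _ _ t)))) (sym (¬T⇒≡false (λ t → <-asym q<p (<ᵇ⇒< _ _ t))))
  ... | inj₂ (inj₂ (q<p , inj₂ (_ , lt))) = ⊥-elim (<-asym lt (n<1+n _))

  free-right : ∀ {w p m} → ColumnWord w → (p , suc m) ∈ w →
    filterᵇ (λ x → col p <ᵇ suc x) (row m w) ≡ map (col ∘ proj₁) (filterᵇ (after m p) w)
  free-right {w} {p} {m} cwd p∈ =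
    trans (filterᵇ-map (λ x → col p <ᵇ suc x) (col ∘ proj₁) (occ m w)) (cong (map (col ∘ proj₁))
      (trans (filterᵇ-cong-∈ (occ m w) same) (filterᵇ-∧ (λ e → p <ᵇ proj₁ e) (λ e → proj₂ e ≡ᵇ m) w)))
    where
    same : ∀ {e} → e ∈ occ m w → (col p <ᵇ suc (col (proj₁ e))) ≡ (p <ᵇ proj₁ e)
    same e∈ with ∈-occ⁻ m w e∈
    ... | e∈w , refl = weakly-right⇔after cwd p∈ e∈w

  nextOcc-pick : ∀ {w p m} → ColumnWord w → (p , suc m) ∈ w → row m w ≢ [] →
    ∃ λ q → (q , m) ∈ w × nextOcc m p w ≡ just q × pick (col p) (row m w) ≡ just (col q , (q <ᵇ p))
  -- The occurrences after `p` and all occurrences become variables tied by equations; `search` then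
  -- treats the direct and the wrapping case for both searches at once.
  nextOcc-pick {w} {p} {m} cwd p∈ ne = search _ _ refl refl
    where
    q<p : ∀ {q} → (q , m) ∈ w → ¬ T (p <ᵇ q) → T (q <ᵇ p)
    q<p q∈ p≮q = <⇒<ᵇ (≤∧≢⇒< (≮⇒≥ (p≮q ∘ <⇒<ᵇ)) λ q≡p → 1+n≢n (cong proj₂ (pos-injective cwd p∈ q∈ (sym q≡p))))
    search : ∀ right all → filterᵇ (after m p) w ≡ right → occ m w ≡ all →
      ∃ λ q → (q , m) ∈ w × nextOcc m p w ≡ just q × pick (col p) (row m w) ≡ just (col q , (q <ᵇ p))
    search ((q , j) ∷ es) _ eq _ with ∈-filterᵇ⁻ (after m p) w (subst ((q , j) ∈_) (sym eq) (here refl))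
    ... | q∈w , t with Equivalence.to T-∧ t
    ...   | tj , p<q with ≡ᵇ⇒≡ j m tj
    ...     | refl = q , q∈w , nextOcc-right m p w eq ,
      trans (pick-direct (col p) (row m w) (trans (free-right cwd p∈) (cong (map (col ∘ proj₁)) eq)))
        (cong (λ b → just (col q , b)) (sym (¬T⇒≡false (λ q<p → <-asym (<ᵇ⇒< p q p<q) (<ᵇ⇒< q p q<p)))))
    search [] [] _ eo = ⊥-elim (ne (cong (map (col ∘ proj₁)) eo))
    search [] ((q , j) ∷ es) eq eo with ∈-occ⁻ m w (subst ((q , j) ∈_) (sym eo) (here refl))
    ... | q∈w , refl = q , q∈w , nextOcc-left m p w eq eo ,
      trans (pick-wrapped (col p) (row m w) (trans (free-right cwd p∈) (cong (map (col ∘ proj₁)) eq)) (cong (map (col ∘ proj₁)) eo))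
        (cong (λ b → just (col q , b)) (sym (T⇒≡true (q<p q∈w p≮q))))
      where
      p≮q : ¬ T (p <ᵇ q)
      p≮q t with () ← subst ((q , m) ∈_) eq (∈-filterᵇ⁺ (after m p) q∈w (Equivalence.from T-∧ (≡⇒≡ᵇ m m refl , t)))

  -- Iterating `nextOcc-pick` down the rows gives a single chain that describes the choice made by
  -- charge, the weight of the strand and the rows left after its removal.
  chain-exists : ∀ l m {p w} → ColumnWord w → (p , suc m) ∈ w → All (_≢ []) (rows m w) →
    ∃ λ es → Chain w m es × chooseFrom m p w ≡ map proj₁ es
           × strandWt l (suc m) (col p) (rows m w) ≡ chainWt l p es
           × removeStrand (col p) (rows m w) ≡ map (λ e → removeCol (col (proj₁ e)) (row (proj₂ e) w)) es
  chain-exists l zero cwd p∈ [] = [] , [] , refl , refl , refl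
  chain-exists l (suc m) cwd p∈ (ne ∷ nes) with nextOcc-pick cwd p∈ ne
  ... | q , q∈ , nx , pk with chain-exists l m cwd q∈ nes
  ...   | es , ch , ec , ew , er rewrite nx | pk =
    (q , suc m) ∷ es , q∈ ∷ ch , cong (q ∷_) ec , cong (_ +_) ew , cong (_ ∷_) er

  onChain⇒∈ : ∀ {w m es e} → ColumnWord w → Chain w m es → e ∈ w → T (onChain es e) → e ∈ es
  onChain⇒∈ {es = es} cwd ch e∈w t with ∈-map⁻ proj₁ (memb⇒∈ (map proj₁ es) t)
  ... | e' , e'∈ , eq = subst (_∈ es) (sym (pos-injective cwd e∈w (chain-⊆ ch e'∈) eq)) e'∈

  -- Charge deletes by position, pairing deletes by column. The chain has only one letter `j`, and a
  -- site determines its position, so among the letters `j` both deletions hit the same single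
  -- occurrence.
  row-remainder : ∀ {w k es q j} → ColumnWord w → Chain w k es → (q , j) ∈ es →
    row j (remainder es w) ≡ removeCol (col q) (row j w)
  row-remainder {w} {k} {es} {q} {j} cwd ch q∈ =
    trans (cong (map (col ∘ proj₁))
      (trans (filterᵇ-comm _ _ w) (filterᵇ-cong-∈ (occ j w) same)))
      (sym (filterᵇ-map _ (col ∘ proj₁) (occ j w)))
    where
    same : ∀ {e} → e ∈ occ j w → (if onChain es e then false else true) ≡ (if col (proj₁ e) ≡ᵇ col q then false else true)
    same {e} e∈ with ∈-occ⁻ j w e∈
    ... | e∈w , refl = cong (λ b → if b then false else true) (T-ext
      (λ t → ≡⇒≡ᵇ (col (proj₁ e)) (col q)
        (cong (col ∘ proj₁) (chain-letter-injective ch (onChain⇒∈ cwd ch e∈w t) q∈ refl)))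
      (λ t → subst (λ x → T (memb x (map proj₁ es)))
        (sym (site-injective cwd e∈w (chain-⊆ ch q∈) (≡ᵇ⇒≡ _ _ t))) (∈⇒onChain q∈)))

  -- The induction runs over the part `ds` of the chain while the deleted letters remain those of
  -- all of `es`.
  rows-remainder : ∀ {w k es m ds} → ColumnWord w → Chain w k es → Chain w m ds → (∀ {e} → e ∈ ds → e ∈ es) →
    rows m (remainder es w) ≡ map (λ e → removeCol (col (proj₁ e)) (row (proj₂ e) w)) ds
  rows-remainder cwd ch [] _ = refl
  rows-remainder cwd ch (q∈ ∷ ds) ds⊆ =
    cong₂ _∷_ (row-remainder cwd ch (ds⊆ (here refl))) (rows-remainder cwd ch ds (ds⊆ ∘ there))

  -- The subword lists the chain in the order of the word instead of by decreasing letter. Both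
  -- lists have the same members and no repetitions, hence are permutations of each other.
  length-subword : ∀ {w k es} → ColumnWord w → Chain w k es → length (subword es w) ≡ k
  length-subword {w} {k} {es} cwd ch = trans (Permₚ.↭-length (∼bag⇒↭ (unique∧set⇒bag
      (AllPairs.map (λ (lt , _) eq → <⇒≢ lt (cong proj₁ eq)) (AllPairsₚ.filter⁺ (T? ∘ onChain es) cwd))
      (chain-Unique ch)
      (mk⇔ to (λ e∈ → ∈-filterᵇ⁺ (onChain es) (chain-⊆ ch e∈) (∈⇒onChain e∈))))))
    (chain-length ch)
    where
    to : ∀ {e} → e ∈ subword es w → e ∈ es
    to e∈ with ∈-filterᵇ⁻ (onChain es) w e∈
    ... | e∈w , t = onChain⇒∈ cwd ch e∈w t

  chargePerm-subword : ∀ {w m p es} → ColumnWord w → Chain w (suc m) ((p , suc m) ∷ es) →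
    chargePerm (map proj₂ (subword ((p , suc m) ∷ es) w)) ≡ chainWt (suc m) p es
  chargePerm-subword {w} {m} {p} {es} cwd ch@(_ ∷ ch')
    -- The `k` of `chargePerm`, a length, becomes `suc m`, which is the label of the strand.
    rewrite length-map proj₂ (subword ((p , suc m) ∷ es) w) | length-subword cwd ch
    = sum-ascents V (suc m)
        (AllPairs.map proj₁ (AllPairsₚ.filter⁺ (T? ∘ onChain ES) cwd))
        (λ e∈ e'∈ → chain-letter-injective ch (V⊆ e∈) (V⊆ e'∈))
        ch' (⊆V ∘ there) (⊆V (here refl))
    where
    ES = (p , suc m) ∷ es
    V = subword ES w
    V⊆ : ∀ {e} → e ∈ V → e ∈ ES
    V⊆ e∈ with ∈-filterᵇ⁻ (onChain ES) w e∈
    ... | e∈w , t = onChain⇒∈ cwd ch e∈w t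
    ⊆V : ∀ {e} → e ∈ ES → e ∈ V
    ⊆V e∈ = ∈-filterᵇ⁺ (onChain ES) (chain-⊆ ch e∈) (∈⇒onChain e∈)

  -- Every row met by the chain loses exactly one ball, so comparisons of row lengths survive.
  Growing-remainder : ∀ {w k es m ds} → ColumnWord w → Chain w k es → Chain w m ds → (∀ {e} → e ∈ ds → e ∈ es) →
    Growing (rows m w) → Growing (rows m (remainder es w))
  Growing-remainder cwd ch [] _ _ = []
  Growing-remainder cwd ch (_ ∷ []) _ _ = [-]
  Growing-remainder {w} {es = es} cwd ch (_ ∷ ds@(_ ∷ _)) ds⊆ (le ∷ g) =
    ≤-pred (subst₂ _≤_ (shrink (ds⊆ (here refl))) (shrink (ds⊆ (there (here refl)))) le) ∷
    Growing-remainder cwd ch ds (ds⊆ ∘ there) g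
    where
    shrink : ∀ {q j} → (q , j) ∈ es → length (row j w) ≡ suc (length (row j (remainder es w)))
    shrink {q} {j} q∈ = trans (length-removeCol (row-Sorted j cwd) (∈-row (chain-⊆ ch q∈)))
      (cong (suc ∘ length) (sym (row-remainder cwd ch q∈)))

  -- Induction on `k` and the fuel. If `k` does not occur, the top row is empty and `k` drops
  -- without a round of charge; otherwise one round removes one strand and `k` stays.
  chargeRounds≡strandMaj : ∀ k f w → ColumnWord w → All (λ e → 1 ≤ proj₂ e × proj₂ e ≤ k) w →
    length w ≤ f → Growing (rows k w) → chargeRounds f w ≡ strandMaj k [] (rows k w)
  chargeRounds≡strandMaj zero f [] _ _ _ _ = chargeRounds-[] f
  chargeRounds≡strandMaj zero f (e ∷ w) _ ((1≤ , ≤0) ∷ _) _ _ with () ← ≤-trans 1≤ ≤0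
  chargeRounds≡strandMaj (suc m) f w cwd letters fuel grow with occ (suc m) w in eo
  ... | [] = trans (chargeRounds≡strandMaj m f w cwd letters' fuel (Linked.tail grow)) (sym (strandMaj-[] (suc m) (rows m w)))
    where
    letters' : All (λ e → 1 ≤ proj₂ e × proj₂ e ≤ m) w
    letters' = All.tabulate λ {e} e∈ → proj₁ (All.lookup letters e∈) ,
      ≤-pred (≤∧≢⇒< (proj₂ (All.lookup letters e∈)) λ { refl → case subst (e ∈_) eo (∈-occ⁺ e∈) of λ () })
  chargeRounds≡strandMaj (suc m) zero [] cwd letters fuel grow | _ ∷ _ with () ← eo
  chargeRounds≡strandMaj (suc m) (suc f) w cwd letters fuel grow | (p , j) ∷ os
    with ∈-occ⁻ (suc m) w (subst ((p , j) ∈_) (sym eo) (here refl))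
  ... | p∈ , refl with chain-exists (suc m) m cwd p∈ (nonempty-below grow)
  ...   | es , ch , ec , ew , er = begin
      chargeRounds (suc f) w
        ≡⟨ cong (λ c → chargePerm (map proj₂ (filterᵇ (λ e → memb (proj₁ e) c) w))
                       + chargeRounds f (filterᵇ (λ e → if memb (proj₁ e) c then false else true) w)) chosen ⟩
      chargePerm (map proj₂ (subword ES w)) + chargeRounds f (remainder ES w)
        ≡⟨ cong₂ _+_ (trans (chargePerm-subword cwd ch') (sym ew))
             (chargeRounds≡strandMaj (suc m) f (remainder ES w) (AllPairsₚ.filter⁺ _ cwd) (Allₚ.filter⁺ _ letters)
               -- The letter at `p` is itself deleted, so the remaining word is strictly shorter and
               -- the smaller fuel suffices.
               (≤-pred (≤-trans (filter-notAll _ w (lose p∈ (λ t → if-flip t (∈⇒onChain {ES} {p , suc m} (here refl))))) fuel))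
               (Growing-remainder cwd ch' ch' id (subst (λ o → Growing (map (col ∘ proj₁) o ∷ rows m w)) (sym eo) grow))) ⟩
      strandWt (suc m) (suc m) (col p) (rows m w) + strandMaj (suc m) [] (rows (suc m) (remainder ES w))
        ≡⟨ cong (λ z → strandWt (suc m) (suc m) (col p) (rows m w) + strandMaj (suc m) [] z)
             (trans (rows-remainder cwd ch' ch' id) (cong₂ (λ o t → removeCol (col p) (map (col ∘ proj₁) o) ∷ t) eo (sym er))) ⟩
      strandWt (suc m) (suc m) (col p) (rows m w) +
        strandMaj (suc m) [] (removeCol (col p) (col p ∷ map (col ∘ proj₁) os) ∷ removeStrand (col p) (rows m w))
        ≡⟨ sym (peel (suc m) (col p) (suc m) [] (col p ∷ map (col ∘ proj₁) os) (rows m w) (nonempty-below grow) (rows-Sorted m cwd)) ⟩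
      strandMaj (suc m) ((col p , suc m) ∷ []) ((col p ∷ map (col ∘ proj₁) os) ∷ rows m w)
        ≡⟨ sym (strandMaj-start (suc m) (col p) (map (col ∘ proj₁) os) (rows m w) p-least) ⟩
      strandMaj (suc m) [] ((col p ∷ map (col ∘ proj₁) os) ∷ rows m w) ∎
    where
    open ≡-Reasoning
    ES = (p , suc m) ∷ es
    ch' : Chain w (suc m) ES
    ch' = p∈ ∷ ch
    -- The first occurrence of the largest letter is the leftmost ball of the top row.
    p-least : All (col p <_) (map (col ∘ proj₁) os)
    p-least with subst (Sorted ∘ map (col ∘ proj₁)) eo (row-Sorted (suc m) cwd)
    ... | h ∷ _ = h
    chosen : firstChosen w ≡ map proj₁ ES
    chosen = trans (firstChosen-eq (≤-antisym (maxLetter-≤ (All.map proj₂ letters)) (maxLetter-≥ p∈)) eo) (cong (p ∷_) ec)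

-- Filters, reversal and enumeration of finite sets.

filterᵇ-concatMap : (p : B → Bool) (f : A → List B) (xs : List A) →
  filterᵇ p (concatMap f xs) ≡ concatMap (filterᵇ p ∘ f) xs
filterᵇ-concatMap p f [] = refl
filterᵇ-concatMap p f (x ∷ xs) = trans (filter-++ (T? ∘ p) (f x) (concatMap f xs)) (cong (filterᵇ p (f x) ++_) (filterᵇ-concatMap p f xs))

concatMap-if : (p : A → Bool) (f : A → B) (xs : List A) →
  concatMap (λ x → if p x then f x ∷ [] else []) xs ≡ map f (filterᵇ p xs)
concatMap-if p f [] = refl
concatMap-if p f (x ∷ xs) with p x
... | true = cong (f x ∷_) (concatMap-if p f xs)
... | false = concatMap-if p f xs

length-filterᵇ-mono : {p q : A → Bool} → (∀ x → T (p x) → T (q x)) → ∀ xs → length (filterᵇ p xs) ≤ length (filterᵇ q xs)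
length-filterᵇ-mono h [] = z≤n
length-filterᵇ-mono {p = p} {q} h (x ∷ xs) with p x | q x | h x
... | true | true | _ = s≤s (length-filterᵇ-mono h xs)
... | true | false | f = ⊥-elim (f tt)
... | false | true | _ = m≤n⇒m≤1+n (length-filterᵇ-mono h xs)
... | false | false | _ = length-filterᵇ-mono h xs

AllPairs-reverse : ∀ {R : A → A → Set} {xs} → AllPairs R xs → AllPairs (flip R) (reverse xs)
AllPairs-reverse [] = []
AllPairs-reverse {R = R} {x ∷ xs} (h ∷ hs) rewrite unfold-reverse x xs =
  AllPairsₚ.++⁺ (AllPairs-reverse hs) ([] ∷ []) (All.map (_∷ []) (All-resp-↭ (↭-sym (↭-reverse xs)) h))

conj-antitone : ∀ p r → conj p (suc r) ≤ conj p r
conj-antitone p r = length-filterᵇ-mono {p = λ a → suc r <ᵇ suc a} {q = λ a → r <ᵇ suc a}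
  (λ a t → <⇒<ᵇ (<-trans (n<1+n r) (<ᵇ⇒< (suc r) (suc a) t))) p

tabulate-toList : ∀ {n} (f : Fin n → A) → toList (Vec.tabulate f) ≡ List.tabulate f
tabulate-toList {n = zero} f = refl
tabulate-toList {n = suc n} f = cong (f Fin.zero ∷_) (tabulate-toList (f ∘ Fin.suc))

∈-fins : ∀ {n} (i : Fin n) → i ∈ toList (allFin n)
∈-fins i = subst (i ∈_) (sym (tabulate-toList id)) (∈-allFin i)

fins-< : ∀ n → AllPairs Fin._<_ (toList (allFin n))
fins-< n = subst (AllPairs Fin._<_) (sym (tabulate-toList id)) (AllPairsₚ.tabulate⁺-< id)

length-filterᵇ-lookup : ∀ {n} (S : Subset n) (f : Fin n → A) (p : A → Bool) → (∀ i → p (f i) ≡ lookup S i) →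
  length (filterᵇ p (toList (Vec.tabulate f))) ≡ ∣ S ∣
length-filterᵇ-lookup Vec.[] f p h = refl
length-filterᵇ-lookup (true Vec.∷ S) f p h rewrite h Fin.zero = cong suc (length-filterᵇ-lookup S (f ∘ Fin.suc) p (h ∘ Fin.suc))
length-filterᵇ-lookup (false Vec.∷ S) f p h rewrite h Fin.zero = length-filterᵇ-lookup S (f ∘ Fin.suc) p (h ∘ Fin.suc)

length-rowCols : ∀ {n} (S : Subset n) → length (rowCols S) ≡ ∣ S ∣
length-rowCols {n} S = trans (length-map toℕ (filterᵇ (lookup S) (toList (allFin n)))) (length-filterᵇ-lookup S id (lookup S) (λ _ → refl))

-- From positions in a word back to columns.

colAt : List (ℕ × ℕ) → ℕ → ℕ
colAt [] _ = 0
colAt (x ∷ xs) zero = proj₁ x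
colAt (x ∷ xs) (suc t) = colAt xs t

-- The offset `i` serves the induction: `col` is fixed for the whole word, while `colAt xs` counts
-- from the start of the part still to be read.
numbered-cells : ∀ (col : ℕ → ℕ) i xs → (∀ t → col (i + t) ≡ colAt xs t) →
  map (λ e → col (proj₁ e) , proj₂ e) (numbered i (map proj₂ xs)) ≡ xs
numbered-cells col i [] h = refl
numbered-cells col i ((c , a) ∷ xs) h = cong₂ (λ x → (x , a) ∷_)
  (trans (cong col (sym (+-identityʳ i))) (h 0))
  (numbered-cells col (suc i) xs (λ t → trans (cong col (sym (+-suc i t))) (h (suc t))))

numbered-≥ : ∀ i xs → All (λ e → i ≤ proj₁ e) (numbered i xs)
numbered-≥ i [] = []
numbered-≥ i (x ∷ xs) = ≤-refl ∷ All.map <⇒≤ (numbered-≥ (suc i) xs)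

numbered-< : ∀ i xs → AllPairs (λ e e' → proj₁ e < proj₁ e') (numbered i xs)
numbered-< i [] = []
numbered-< i (x ∷ xs) = numbered-≥ (suc i) xs ∷ numbered-< (suc i) xs

length-numbered : ∀ i xs → length (numbered i xs) ≡ length xs
length-numbered i [] = refl
length-numbered i (x ∷ xs) = cong suc (length-numbered (suc i) xs)

-- The balls of a multiline queue in reading order.

CellBefore : ℕ × ℕ → ℕ × ℕ → Set
CellBefore (c , a) (d , b) = c < d ⊎ (c ≡ d × b < a)

hasLetter : ∀ {L} → Fin L → ℕ × ℕ → Bool
hasLetter i e = proj₂ e ≡ᵇ suc (toℕ i)

module _ {L n : ℕ} (M : Vec (Subset n) L) where

  site : Fin n → Fin L → List (ℕ × ℕ)
  site j i = if lookup (lookup M i) j then (toℕ j , suc (toℕ i)) ∷ [] else []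

  column : Fin n → List (ℕ × ℕ)
  column j = concatMap (site j) (reverse (toList (allFin L)))

  -- The column word with each letter accompanied by its column, which `cw` forgets.
  cells : List (ℕ × ℕ)
  cells = concatMap column (toList (allFin n))

  cw-cells : cw M ≡ map proj₂ cells
  cw-cells = sym (trans (map-concatMap proj₂ column (toList (allFin n)))
    (concatMap-cong (λ j → trans (map-concatMap proj₂ (site j) (reverse (toList (allFin L))))
      (concatMap-cong (letter j) (reverse (toList (allFin L))))) (toList (allFin n))))
    where
    letter : ∀ j i → map proj₂ (site j i) ≡ (if lookup (lookup M i) j then suc (toℕ i) ∷ [] else [])
    letter j i with lookup (lookup M i) j
    ... | true = refl
    ... | false = refl

  site-same : ∀ j i → filterᵇ (hasLetter i) (site j i) ≡ site j i
  site-same j i with lookup (lookup M i) j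
  ... | false = refl
  ... | true rewrite T⇒≡true (≡⇒≡ᵇ (toℕ i) (toℕ i) refl) = refl

  site-other : ∀ j {i i'} → i' ≢ i → filterᵇ (hasLetter i) (site j i') ≡ []
  site-other j {i} {i'} i'≢i with lookup (lookup M i') j
  ... | false = refl
  ... | true rewrite ¬T⇒≡false (i'≢i ∘ Finₚ.toℕ-injective ∘ ≡ᵇ⇒≡ (toℕ i') (toℕ i)) = refl

  sites-other : ∀ j {i is} → All (_≢ i) is → concatMap (filterᵇ (hasLetter i) ∘ site j) is ≡ []
  sites-other j [] = refl
  sites-other j (h ∷ hs) = cong₂ _++_ (site-other j h) (sites-other j hs)

  -- Strictly decreasing indices contain `i` only once, and the sites of all other rows carry other
  -- letters.
  sites-filter : ∀ j {i is} → AllPairs Fin._>_ is → i ∈ is → concatMap (filterᵇ (hasLetter i) ∘ site j) is ≡ site j i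
  sites-filter j {i} (h ∷ _) (here refl) =
    trans (cong₂ _++_ (site-same j i) (sites-other j (All.map (λ gt eq → Finₚ.<⇒≢ gt eq) h))) (++-identityʳ (site j i))
  sites-filter j (h ∷ hs) (there i∈) =
    cong₂ _++_ (site-other j (λ eq → Finₚ.<⇒≢ (All.lookup h i∈) (sym eq))) (sites-filter j hs i∈)

  row-cells : ∀ i → map proj₁ (filterᵇ (hasLetter i) cells) ≡ rowCols (lookup M i)
  row-cells i = begin
    map proj₁ (filterᵇ (hasLetter i) cells)
      ≡⟨ cong (map proj₁) (filterᵇ-concatMap (hasLetter i) column (toList (allFin n))) ⟩
    map proj₁ (concatMap (filterᵇ (hasLetter i) ∘ column) (toList (allFin n)))
      ≡⟨ cong (map proj₁) (concatMap-cong (λ j → trans (filterᵇ-concatMap (hasLetter i) (site j) (reverse (toList (allFin L))))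
           (sites-filter j (AllPairs-reverse (fins-< L)) (reverse⁺ (∈-fins i)))) (toList (allFin n))) ⟩
    map proj₁ (concatMap (λ j → site j i) (toList (allFin n)))
      ≡⟨ cong (map proj₁) (concatMap-if (lookup (lookup M i)) (λ j → toℕ j , suc (toℕ i)) (toList (allFin n))) ⟩
    map proj₁ (map (λ j → toℕ j , suc (toℕ i)) (filterᵇ (lookup (lookup M i)) (toList (allFin n))))
      ≡⟨ sym (map-∘ (filterᵇ (lookup (lookup M i)) (toList (allFin n)))) ⟩
    rowCols (lookup M i) ∎
    where open ≡-Reasoning

  site-All : ∀ {P : ℕ × ℕ → Set} j i → P (toℕ j , suc (toℕ i)) → All P (site j i)
  site-All j i h with lookup (lookup M i) j
  ... | true = h ∷ []
  ... | false = []

  site-AllPairs : ∀ j i → AllPairs CellBefore (site j i)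
  site-AllPairs j i with lookup (lookup M i) j
  ... | true = [] ∷ []
  ... | false = []

  column-All : ∀ {P : ℕ × ℕ → Set} j → (∀ i → P (toℕ j , suc (toℕ i))) → All P (column j)
  column-All j h = Allₚ.concat⁺ (Allₚ.map⁺ (All.universal (λ i → site-All j i (h i)) (reverse (toList (allFin L)))))

  cells-All : ∀ {P : ℕ × ℕ → Set} → (∀ j i → P (toℕ j , suc (toℕ i))) → All P cells
  cells-All h = Allₚ.concat⁺ (Allₚ.map⁺ (All.universal (λ j → column-All j (h j)) (toList (allFin n))))

  column-AllPairs : ∀ j → AllPairs CellBefore (column j)
  column-AllPairs j = AllPairsₚ.concat⁺ (Allₚ.map⁺ (All.universal (site-AllPairs j) (reverse (toList (allFin L)))))
    (AllPairsₚ.map⁺ (AllPairs.map (λ {i} {i'} gt → site-All j i (site-All j i' (inj₂ (refl , s≤s gt))))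
      (AllPairs-reverse (fins-< L))))

  cells-AllPairs : AllPairs CellBefore cells
  cells-AllPairs = AllPairsₚ.concat⁺ (Allₚ.map⁺ (All.universal column-AllPairs (toList (allFin n))))
    (AllPairsₚ.map⁺ (AllPairs.map (λ {j} {j'} lt → column-All j (λ _ → column-All j' (λ _ → inj₁ lt))) (fins-< n)))

  word : List (ℕ × ℕ)
  word = numbered 0 (map proj₂ cells)

  col : ℕ → ℕ
  col = colAt cells

  word-cells : map (λ e → col (proj₁ e) , proj₂ e) word ≡ cells
  word-cells = numbered-cells col 0 cells (λ _ → refl)

  word-ColumnWord : ColumnWord col word
  word-ColumnWord = AllPairs.zip (numbered-< 0 (map proj₂ cells) ,
    AllPairsₚ.map⁻ (subst (AllPairs CellBefore) (sym word-cells) cells-AllPairs))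

  word-letters : All (λ e → 1 ≤ proj₂ e × proj₂ e ≤ L) word
  word-letters = Allₚ.map⁻ (subst (All _) (sym word-cells)
    (cells-All {λ e → 1 ≤ proj₂ e × proj₂ e ≤ L} (λ _ i → s≤s z≤n , Finₚ.toℕ<n i)))

  row-word : ∀ i → row col (suc (toℕ i)) word ≡ rowCols (lookup M i)
  row-word i = begin
    map (col ∘ proj₁) (filterᵇ (hasLetter i) word)
      ≡⟨ map-∘ (filterᵇ (hasLetter i) word) ⟩
    map proj₁ (map (λ e → col (proj₁ e) , proj₂ e) (filterᵇ (hasLetter i) word))
      ≡⟨ cong (map proj₁) (sym (filterᵇ-map (hasLetter i) _ word)) ⟩
    map proj₁ (filterᵇ (hasLetter i) (map (λ e → col (proj₁ e) , proj₂ e) word))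
      ≡⟨ cong (map proj₁ ∘ filterᵇ (hasLetter i)) word-cells ⟩
    map proj₁ (filterᵇ (hasLetter i) cells)
      ≡⟨ row-cells i ⟩
    rowCols (lookup M i) ∎
    where open ≡-Reasoning

-- Rows of the word, rows of the queue, and the conclusion.

rows-applyDownFrom : ∀ col w m → rows col m w ≡ applyDownFrom (λ t → row col (suc t) w) m
rows-applyDownFrom col w zero = refl
rows-applyDownFrom col w (suc m) = cong (row col (suc m) w ∷_) (rows-applyDownFrom col w m)

toList-applyUpTo : ∀ {L} (v : Vec A L) (f : ℕ → A) → (∀ i → f (toℕ i) ≡ lookup v i) → toList v ≡ applyUpTo f L
toList-applyUpTo Vec.[] f h = refl
toList-applyUpTo (x Vec.∷ v) f h = cong₂ _∷_ (sym (h Fin.zero)) (toList-applyUpTo v (f ∘ suc) (h ∘ Fin.suc))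

rows-word : ∀ {L n} (M : Vec (Subset n) L) → rows (col M) L (word M) ≡ reverse (toList (Vec.map rowCols M))
rows-word {L} M = begin
  rows (col M) L (word M)                ≡⟨ rows-applyDownFrom (col M) (word M) L ⟩
  applyDownFrom rowAt L                  ≡⟨ sym (reverse-applyUpTo rowAt L) ⟩
  reverse (applyUpTo rowAt L)            ≡⟨ cong reverse (sym (toList-applyUpTo (Vec.map rowCols M) rowAt
                                              (λ i → trans (row-word M i) (sym (Vecₚ.lookup-map i rowCols M))))) ⟩
  reverse (toList (Vec.map rowCols M))   ∎
  where
  open ≡-Reasoning
  rowAt : ℕ → List ℕ
  rowAt t = row (col M) (suc t) (word M)

rows-Growing : ∀ {col w} m → (∀ j → suc j < m → length (row col (suc (suc j)) w) ≤ length (row col (suc j) w)) →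
  Growing (rows col m w)
rows-Growing zero h = []
rows-Growing (suc zero) h = [-]
rows-Growing (suc (suc m)) h = h m (n<1+n (suc m)) ∷ rows-Growing (suc m) (λ j lt → h j (m<n⇒m<1+n lt))

fmMaj≡strandMaj-start : ∀ r rs → All Sorted rs → Growing rs → fmMaj r [] rs ≡ strandMaj r [] rs
fmMaj≡strandMaj-start r [] _ _ = refl
fmMaj≡strandMaj-start r (row ∷ rest) s g =
  fmMaj≡strandMaj r row rest ≋-refl (record { desc = [] ; ≥row = [] }) tt s g

theorem3p17 : (p : List ℕ) → IsPartition p → (n : ℕ) → length p ≤ n →
    (M : Vec (Subset n) (largest p)) → IsMLQ p M → maj M ≡ charge (cw M)
theorem3p17 p _ n _ M mlq = begin
  fmMaj L [] (reverse (toList (Vec.map rowCols M)))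
    ≡⟨ cong (fmMaj L []) (sym (rows-word M)) ⟩
  fmMaj L [] (rows (col M) L (word M))
    ≡⟨ fmMaj≡strandMaj-start L _ (rows-Sorted (col M) L (word-ColumnWord M)) growing ⟩
  strandMaj L [] (rows (col M) L (word M))
    ≡⟨ sym (chargeRounds≡strandMaj (col M) L (length (map proj₂ (cells M))) (word M) (word-ColumnWord M) (word-letters M)
         (≤-reflexive (length-numbered 0 (map proj₂ (cells M)))) growing) ⟩
  chargeRounds (length (map proj₂ (cells M))) (word M)
    ≡⟨ cong (chargeRounds (length (map proj₂ (cells M)))) (sym (positioned≡numbered (map proj₂ (cells M)))) ⟩
  charge (map proj₂ (cells M))
    ≡⟨ cong charge (sym (cw-cells M)) ⟩
  charge (cw M) ∎
  where
  open ≡-Reasoning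
  L = largest p
  length-row : ∀ {t} → t < L → length (row (col M) (suc t) (word M)) ≡ conj p (suc t)
  length-row t<L = subst (λ t → length (row (col M) (suc t) (word M)) ≡ conj p (suc t)) (Finₚ.toℕ-fromℕ< t<L)
    (trans (cong length (row-word M (fromℕ< t<L))) (trans (length-rowCols (lookup M (fromℕ< t<L))) (mlq (fromℕ< t<L))))
  -- The shape enters here: row lengths are parts of the conjugate partition, which weakly decrease
  -- as the row number rises.
  growing : Growing (rows (col M) L (word M))
  growing = rows-Growing L (λ j lt → subst₂ _≤_ (sym (length-row lt)) (sym (length-row (<-trans (n<1+n j) lt)))
    (conj-antitone p (suc j)))
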